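{- For every positive integer $k$ there exists a constant $A_k$ such that for every tree $\mathcal{S}$ on $s$ vertices and every integer $t\ge 2$, we have $f(\mathcal{S},P_t)\le A_k\, s\, t\, \alpha_k(t)$.
   Context: $P_t$ denotes the path on $t$ vertices. For graphs $\mathcal{S},\mathcal{T}$, the constrained Ramsey number $f(\mathcal{S},\mathcal{T})$ is the least $N$ such that every edge-coloring of $K_N$ (with an arbitrary number of colors) contains a monochromatic copy of $\mathcal{S}$ (all edges the same color) or a rainbow copy of $\mathcal{T}$ (all edges distinct colors). The inverse Ackermann hierarchy: $\alpha_1(t)=\lceil t/2\rceil$; for $k\ge2$, $\alpha_k(1)=0$ and $\alpha_k(t)=\min\{r:\alpha_{k-1}^{(r)}(t)=1\}$, where $\alpha_{k-1}^{(r)}$ is the $r$-fold iterate of $\alpha_{k-1}$. -}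

module Defs where

open import Data.Nat using (ℕ; zero; suc; _≤_; _≡ᵇ_; ⌈_/2⌉)
open import Data.Nat.Properties using ()
open import Data.Fin using (Fin; zero; suc; toℕ; fromℕ; inject₁)
open import Data.Bool using (Bool; true; false; T; if_then_else_; _∨_)
open import Data.Product using (Σ; _×_; ∃)
open import Data.Sum using (_⊎_)
open import Relation.Nullary using (¬_)
open import Relation.Binary.PropositionalEquality using (_≡_; _≢_)
open import Function.Definitions using (Injective)

Graph : ℕ → Set
Graph n = Fin n → Fin n → Bool

IsSimple : ∀ {n} → Graph n → Set
IsSimple {n} G = (∀ (u v : Fin n) → G u v ≡ G v u) × (∀ (u : Fin n) → G u u ≡ false)

Walk : ∀ {n} → Graph n → Fin n → Fin n → Set
Walk {n} G u v =
  Σ ℕ λ m → Σ (Fin (suc m) → Fin n) λ w →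
    (w zero ≡ u) × (w (fromℕ m) ≡ v) × (∀ (i : Fin m) → T (G (w (inject₁ i)) (w (suc i))))

Connected : ∀ {n} → Graph n → Set
Connected {n} G = ∀ (u v : Fin n) → Walk G u v

HasCycle : ∀ {n} → Graph n → Set
HasCycle {n} G =
  Σ ℕ λ m → (2 ≤ m) × Σ (Fin (suc m) → Fin n) λ c →
    Injective _≡_ _≡_ c ×
    (∀ (i : Fin m) → T (G (c (inject₁ i)) (c (suc i)))) ×
    T (G (c (fromℕ m)) (c zero))

Acyclic : ∀ {n} → Graph n → Set
Acyclic G = ¬ HasCycle G

IsTree : ∀ {n} → Graph n → Set
IsTree G = IsSimple G × Connected G × Acyclic G

PathGraph : (t : ℕ) → Graph t
PathGraph t i j = (suc (toℕ i) ≡ᵇ toℕ j) ∨ (suc (toℕ j) ≡ᵇ toℕ i)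

-- Edge colourings of K_N (colours taken from ℕ; arbitrary number of colours)

Colouring : ℕ → Set
Colouring N = Fin N → Fin N → ℕ

IsEdgeColouring : ∀ {N} → Colouring N → Set
IsEdgeColouring {N} c = ∀ (u v : Fin N) → c u v ≡ c v u

MonoCopy : ∀ {s N} → Graph s → Colouring N → Set
MonoCopy {s} {N} S c =
  Σ (Fin s → Fin N) λ φ → Injective _≡_ _≡_ φ ×
    Σ ℕ λ col → ∀ (u v : Fin s) → T (S u v) → c (φ u) (φ v) ≡ col

RainbowCopy : ∀ {h N} → Graph h → Colouring N → Set
RainbowCopy {h} {N} H c =
  Σ (Fin h → Fin N) λ ψ → Injective _≡_ _≡_ ψ ×
    (∀ (u v u′ v′ : Fin h) → T (H u v) → T (H u′ v′) →
       c (ψ u) (ψ v) ≡ c (ψ u′) (ψ v′) →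
       ((u ≡ u′) × (v ≡ v′)) ⊎ ((u ≡ v′) × (v ≡ u′)))

RamseyProperty : ∀ {s h} → Graph s → Graph h → ℕ → Set
RamseyProperty S H N =
  ∀ (c : Colouring N) → IsEdgeColouring c → MonoCopy S c ⊎ RainbowCopy H c

-- f(S,H) ≤ M  :⇔  the least N with the Ramsey property is ≤ M,
-- i.e. some N ≤ M has the property.
f≤ : ∀ {s h} → Graph s → Graph h → ℕ → Set
f≤ S H M = ∃ λ N → (N ≤ M) × RamseyProperty S H N

-- Inverse Ackermann hierarchy.
-- count g fuel x = least r < fuel with g^(r)(x) = 1 (fuel is only a
-- termination device; for x ≥ 1 with g decreasing, fuel = x suffices).

count : (ℕ → ℕ) → ℕ → ℕ → ℕ
count g zero    x = zero
count g (suc n) x = if x ≡ᵇ 1 then zero else suc (count g n (g x))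

-- α k t for k ≥ 1 (α 0 is unused junk)
α : ℕ → ℕ → ℕ
α zero t = t
α (suc zero) t = ⌈ t /2⌉
α (suc (suc k)) t = count (α (suc k)) t t

-- The colour classes of a colouring without a monochromatic S are s-degenerate, so the edges can be
-- oriented with at most s out-edges of each colour at every vertex. Only this orientation is used
-- from then on, and it yields the stronger bound f(S, P_t) ≤ 12000 s t; note that α_k(t) ≥ 1.
--
-- If two-coloured cherries v ⟶ w ⟵ v′ abound, a rainbow path is found greedily. Otherwise, for a
-- positive proportion of the vertices w, a positive proportion of all vertices send an edge of one
-- and the same colour, colour w, to w. Among any six such lexical vertices two have many common
-- in-neighbours of this kind; joining two path ends u, w through one of them costs only the colours
-- of u and w. It is therefore enough to find disjoint paths with lexical ends and 5 t vertices in
-- total, all of whose edge colours and end colours are different.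
--
-- A foreign edge, one whose colour is neither that of its first nor that of its second end, is such a
-- path. If a maximal family of these is small, discard all the colours it uses; foreign edges between
-- the remaining vertices have none of the colours of these vertices. A set of vertices of different
-- colours without foreign edges is spanned by a path with the colours of its vertices, all but one of
-- them (a chain), and a foreign edge at its end turns it into a path of the required kind. The vertices
-- used by chains and those used by turns are separated by a bipartition of the colours. Among the
-- vertices with about 12 s 2^i possible turns, a chain can take a proportion 1 / O(s 2^i), and 2^i chains
-- can be turned; so every dyadic level i contributes a proportion 1 / O(s) of its vertices.

module Submission where

open import Defs
import Algebra.Solver.CommutativeMonoid as CommutativeMonoidSolver
open import Data.Bool using (Bool; true; false; not; T; if_then_else_; _xor_)
import Data.Bool.Properties as Bool
open import Data.Bool.Properties using (T-∨; T-≡)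
open import Data.Fin using (Fin; zero; suc; toℕ; fromℕ; fromℕ<; inject₁; inject≤)
import Data.Fin.Properties as F
open import Data.List using (List; []; _∷_; _++_; length; lookup; map; concatMap; take)
import Data.List.Membership.DecPropositional as DecMembership
open import Data.List.Membership.Propositional using (_∈_; _∉_)
open import Data.List.Membership.Propositional.Properties
  using (∈-lookup; ∈-map⁺; ∈-map⁻; ∈-++⁺ʳ; ∈-++⁻)
open import Data.List.Properties using (length-++; length-map; length-take; map-++)
open import Data.List.Relation.Binary.Permutation.Propositional
  using (_↭_; refl; prep; swap; ↭-trans; ↭-sym; ↭-reflexive; ↭⇒↭ₛ)
open import Data.List.Relation.Binary.Permutation.Propositional.Properties
  using (++-commutativeMonoid; ↭-length; shift; map⁺; ++⁺; ++⁺ˡ; ++⁺ʳ; All-resp-↭)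
import Data.List.Relation.Binary.Permutation.Setoid.Properties as Setoid
open import Data.List.Relation.Unary.All as All using (All; []; _∷_)
import Data.List.Relation.Unary.All.Properties as All
open import Data.List.Relation.Unary.AllPairs as AllPairs using (AllPairs; []; _∷_)
import Data.List.Relation.Unary.AllPairs.Properties as AllPairs
open import Data.List.Relation.Unary.Any as Any using (Any; here; there)
open import Data.List.Relation.Unary.Linked using (Linked; [-]; _∷_)
open import Data.List.Relation.Unary.Unique.Propositional using (Unique)
import Data.List.Relation.Unary.Unique.Propositional.Properties as Unique
open import Data.Nat
open import Data.Nat.Properties
open import Data.Nat.Tactic.RingSolver using (solve-∀)
open import Data.Product using (∃; _×_; _,_; proj₁; proj₂)
open import Data.Sum using (_⊎_; inj₁; inj₂; [_,_]′; map₁; map₂)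
open import Data.Unit using (⊤; tt)
open import Data.Vec as Vec using (Vec; []; _∷_; zipWith; replicate; tabulate)
import Data.Vec.Properties as Vec
open import Function using (_∘_; Equivalence)
open import Function.Definitions using (Injective)
open import Relation.Binary using (Decidable; Tri; tri<; tri≈; tri>)
open import Relation.Binary.PropositionalEquality
  using (_≡_; _≢_; refl; sym; trans; cong; cong₂; subst; subst₂; setoid)
open import Relation.Nullary using (¬_; Dec; yes; no; does; contradiction; ¬?)
open import Relation.Nullary.Decidable using (_×-dec_; _⊎-dec_; decidable-stable)
open import Relation.Unary using () renaming (Decidable to Decidable₁)

open import Algebra.Properties.Semiring.Sum +-*-semiring
  using (sum; ∑-distrib-+; ∑-comm; *-distribˡ-sum; *-distribʳ-sum; sum-cong-≋)

-- Finite sums, indicators and counting over `Fin n`.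

module _ where

  private variable
    n m k : ℕ
    A B C : Set
    P Q R : Fin n → Set

  sum-mono : {f g : Fin n → ℕ} → (∀ i → f i ≤ g i) → sum f ≤ sum g
  sum-mono {zero}  f≤g = z≤n
  sum-mono {suc n} f≤g = +-mono-≤ (f≤g zero) (sum-mono (f≤g ∘ suc))

  sum-const : ∀ n k → sum {n} (λ _ → k) ≡ n * k
  sum-const zero    k = refl
  sum-const (suc n) k = cong (k +_) (sum-const n k)

  sum-≤-const : {f : Fin n → ℕ} → (∀ i → f i ≤ k) → sum f ≤ n * k
  sum-≤-const {n} {k} f≤k = ≤-trans (sum-mono f≤k) (≤-reflexive (sum-const n k))

  sum-strict : {f g : Fin n → ℕ} → (∀ i → f i ≤ g i) → ∀ i → f i < g i → sum f < sum g
  sum-strict f≤g zero    lt = +-mono-<-≤ lt (sum-mono (f≤g ∘ suc))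
  sum-strict f≤g (suc i) lt = +-mono-≤-< (f≤g zero) (sum-strict (f≤g ∘ suc) i lt)

  𝟙 : Dec A → ℕ
  𝟙 a? = if does a? then 1 else 0

  𝟙-mono : (A → B) → (a? : Dec A) (b? : Dec B) → 𝟙 a? ≤ 𝟙 b?
  𝟙-mono h (yes a) (yes b) = ≤-refl
  𝟙-mono h (yes a) (no ¬b) = contradiction (h a) ¬b
  𝟙-mono h (no ¬a) b?      = z≤n

  𝟙-⊎ : (A → B ⊎ C) → (a? : Dec A) (b? : Dec B) (c? : Dec C) → 𝟙 a? ≤ 𝟙 b? + 𝟙 c?
  𝟙-⊎ h (no ¬a) b? c? = z≤n
  𝟙-⊎ h (yes a) b? c? with h a
  ... | inj₁ b = ≤-trans (𝟙-mono (λ _ → b) (yes a) b?) (m≤m+n _ _)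
  ... | inj₂ c = ≤-trans (𝟙-mono (λ _ → c) (yes a) c?) (m≤n+m _ _)

  𝟙-yes : (a? : Dec A) → A → 𝟙 a? ≡ 1
  𝟙-yes (yes _) _ = refl
  𝟙-yes (no ¬a) a = contradiction a ¬a

  𝟙-no : (a? : Dec A) → ¬ A → 𝟙 a? ≡ 0
  𝟙-no (yes a) ¬a = contradiction a ¬a
  𝟙-no (no _) _   = refl

  𝟙-bound : (a? : Dec A) {x : ℕ} (k m : ℕ) → (A → x ≤ k * 1 + m) → (¬ A → x ≤ m) → x ≤ k * 𝟙 a? + m
  𝟙-bound (yes a) k m h _ = h a
  𝟙-bound (no ¬a) k m _ h = ≤-trans (h ¬a) (m≤n+m _ (k * 0))

  𝟙-≤ : (a? : Dec A) {k m : ℕ} → (A → k ≤ m) → k * 𝟙 a? ≤ m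
  𝟙-≤ (yes a) {k} h = ≤-trans (≤-reflexive (*-identityʳ k)) (h a)
  𝟙-≤ (no ¬a) {k} h = ≤-trans (≤-reflexive (*-zeroʳ k)) z≤n

  𝟙≤1 : (a? : Dec A) → 𝟙 a? ≤ 1
  𝟙≤1 (yes _) = ≤-refl
  𝟙≤1 (no _)  = z≤n

  module _ {b : ℕ} where
    open DecMembership (F._≟_ {b}) public using (_∈?_)

  -- Opaque so that unification recovers P? from # P?.
  opaque
    # : Decidable₁ P → ℕ
    # P? = sum (λ i → 𝟙 (P? i))

    #-sum : (P? : Decidable₁ P) → # P? ≡ sum (λ i → 𝟙 (P? i))
    #-sum P? = refl

    #-mono : (∀ i → P i → Q i) → (P? : Decidable₁ P) (Q? : Decidable₁ Q) → # P? ≤ # Q?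
    #-mono h P? Q? = sum-mono λ i → 𝟙-mono (h i) (P? i) (Q? i)

    #-strict : (∀ i → P i → Q i) → (P? : Decidable₁ P) (Q? : Decidable₁ Q) → ∀ i → ¬ P i → Q i → # P? < # Q?
    #-strict h P? Q? i ¬p q = sum-strict (λ j → 𝟙-mono (h j) (P? j) (Q? j)) i
      (subst₂ _<_ (sym (𝟙-no (P? i) ¬p)) (sym (𝟙-yes (Q? i) q)) (s≤s z≤n))

    #-⊎ : (∀ i → P i → Q i ⊎ R i) → (P? : Decidable₁ P) (Q? : Decidable₁ Q) (R? : Decidable₁ R) →
          # P? ≤ # Q? + # R?
    #-⊎ h P? Q? R? = ≤-trans (sum-mono λ i → 𝟙-⊎ (h i) (P? i) (Q? i) (R? i))
      (≤-reflexive (∑-distrib-+ (λ i → 𝟙 (Q? i)) (λ i → 𝟙 (R? i))))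

    #-∪∩ : (P? : Decidable₁ P) (Q? : Decidable₁ Q) →
           # P? + # Q? ≤ # (λ i → P? i ⊎-dec Q? i) + # (λ i → P? i ×-dec Q? i)
    #-∪∩ P? Q? = ≤-trans (≤-reflexive (sym (∑-distrib-+ (λ i → 𝟙 (P? i)) (λ i → 𝟙 (Q? i)))))
      (≤-trans (sum-mono λ i → pointwise (P? i) (Q? i))
        (≤-reflexive (∑-distrib-+ (λ i → 𝟙 (P? i ⊎-dec Q? i)) (λ i → 𝟙 (P? i ×-dec Q? i)))))
      where
      pointwise : (a? : Dec A) (b? : Dec B) → 𝟙 a? + 𝟙 b? ≤ 𝟙 (a? ⊎-dec b?) + 𝟙 (a? ×-dec b?)
      pointwise (yes _) (yes _) = ≤-refl
      pointwise (yes _) (no _)  = ≤-refl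
      pointwise (no _)  (yes _) = ≤-refl
      pointwise (no _)  (no _)  = ≤-refl

    #≤n : (P? : Decidable₁ {A = Fin n} P) → # P? ≤ n
    #≤n {n} P? = ≤-trans (sum-≤-const λ i → 𝟙≤1 (P? i)) (≤-reflexive (*-identityʳ n))

    #-guard : (a? : Dec A) (Q? : Decidable₁ {A = Fin n} Q) → (A → # Q? ≤ k) →
              # (λ i → a? ×-dec Q? i) ≤ 𝟙 a? * k
    #-guard {k = k} a?@(yes a) Q? h =
      ≤-trans (#-mono (λ _ → proj₂) (λ i → a? ×-dec Q? i) Q?) (≤-trans (h a) (m≤m+n k 0))
    #-guard {n = n} (no ¬a) Q? h = ≤-reflexive (trans (sum-const n 0) (*-zeroʳ n))

    #-guard-≡ : (a? : Dec A) (Q? : Decidable₁ {A = Fin n} Q) →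
                # (λ i → a? ×-dec Q? i) ≡ 𝟙 a? * # Q?
    #-guard-≡ (yes a) Q? = trans (sum-cong-≋ λ i → lem (Q? i)) (sym (+-identityʳ _))
      where
      lem : ∀ {C : Set} (c? : Dec C) → 𝟙 (yes a ×-dec c?) ≡ 𝟙 c?
      lem (yes _) = refl
      lem (no _)  = refl
    #-guard-≡ {n = n} (no ¬a) Q? = trans (sum-const n 0) (*-zeroʳ n)

    -- This is the form of every greedy choice below: `P` describes the candidates, `Q` those
    -- blocked by earlier choices.
    pick : (P? : Decidable₁ P) (Q? : Decidable₁ Q) → # Q? < # P? → ∃ λ i → P i × ¬ Q i
    pick P? Q? lt with F.any? (λ i → P? i ×-dec ¬? (Q? i))
    ... | yes found = found
    ... | no none   = contradiction
      (#-mono (λ i p → decidable-stable (Q? i) λ ¬q → none (i , p , ¬q)) P? Q?) (<⇒≱ lt)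

    #-empty : (P? : Decidable₁ P) → (∀ i → ¬ P i) → # P? ≡ 0
    #-empty {n} P? none = trans (sum-cong-≋ λ i → 𝟙-no (P? i) (none i)) (trans (sum-const n 0) (*-zeroʳ n))

    #-pos : (P? : Decidable₁ P) → ∀ i → P i → 0 < # P?
    #-pos P? i p = n≢0⇒n>0 λ e → <-irrefl (sym e) (≤-<-trans z≤n (sum-strict (λ _ → z≤n) i
      (subst (0 <_) (sym (𝟙-yes (P? i) p)) (s≤s z≤n))))

    #-nonempty : (P? : Decidable₁ P) → 0 < # P? → ∃ P
    #-nonempty P? lt with F.any? P?
    ... | yes found = found
    ... | no none   = contradiction (#-empty P? (λ i p → none (i , p))) (>⇒≢ lt)

    #-≡ : (x : Fin n) → # (λ i → i F.≟ x) ≤ 1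
    #-≡ {suc n} zero = s≤s (≤-reflexive (#-empty {P = λ (i : Fin n) → suc i ≡ zero} (λ i → suc i F.≟ zero) λ i ()))
    #-≡ {suc n} (suc x) = ≤-trans (#-mono (λ i → F.suc-injective) (λ i → suc i F.≟ suc x) (λ i → i F.≟ x)) (#-≡ x)

    #-colours : ∀ {b} {R : Fin n → Set} (R? : Decidable₁ R) (g : Fin n → Fin b) →
                (∀ γ → # (λ i → R? i ×-dec (g i F.≟ γ)) ≤ k) →
                ∀ γs → # (λ i → R? i ×-dec (g i ∈? γs)) ≤ k * length γs
    #-colours {k = k} R? g h [] = ≤-reflexive (trans (#-empty (λ i → R? i ×-dec (g i ∈? [])) λ { i (_ , ()) }) (sym (*-zeroʳ k)))
    #-colours {k = k} R? g h (γ ∷ γs) = begin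
      # (λ i → R? i ×-dec (g i ∈? (γ ∷ γs)))
        ≤⟨ #-⊎ (λ { i (r , here e) → inj₁ (r , e) ; i (r , there e) → inj₂ (r , e) })
             (λ i → R? i ×-dec (g i ∈? (γ ∷ γs)))
             (λ i → R? i ×-dec (g i F.≟ γ)) (λ i → R? i ×-dec (g i ∈? γs)) ⟩
      # (λ i → R? i ×-dec (g i F.≟ γ)) + # (λ i → R? i ×-dec (g i ∈? γs))
        ≤⟨ +-mono-≤ (h γ) (#-colours R? g h γs) ⟩
      k + k * length γs ≡⟨ sym (*-suc k (length γs)) ⟩
      k * suc (length γs) ∎
      where open ≤-Reasoning

    #-∈ : (xs : List (Fin n)) → # (_∈? xs) ≤ length xs
    #-∈ {n} []   = ≤-reflexive (#-empty {P = λ (i : Fin n) → i ∈ []} (_∈? []) λ i ())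
    #-∈ (x ∷ xs) = ≤-trans
      (#-⊎ (λ { i (here e) → inj₁ e ; i (there e) → inj₂ e }) (_∈? (x ∷ xs)) (λ i → i F.≟ x) (_∈? xs))
      (+-mono-≤ (#-≡ x) (#-∈ xs))

  #-swap : ∀ {m n} {R : Fin m → Fin n → Set} (R? : ∀ i j → Dec (R i j)) →
           sum (λ i → # (R? i)) ≡ sum (λ j → # (λ i → R? i j))
  #-swap R? = trans (sum-cong-≋ λ i → #-sum (R? i))
    (trans (∑-comm λ i j → 𝟙 (R? i j)) (sum-cong-≋ λ j → sym (#-sum λ i → R? i j)))

  -- Otherwise `# P? * g v` exceeds the sum for every `v` in `P`, and adding these inequalities over
  -- `P` makes `# P?` times the sum smaller than itself. The mean is multiplied out so that no
  -- division occurs.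
  average : ∀ {n} {P : Fin n → Set} (P? : Decidable₁ P) (g : Fin n → ℕ) → ∃ P →
            ∃ λ v → P v × # P? * g v ≤ sum (λ i → 𝟙 (P? i) * g i)
  average {n} {P} P? g (u , pu) with F.any? (λ v → P? v ×-dec (# P? * g v ≤? sum (λ i → 𝟙 (P? i) * g i)))
  ... | yes found = found
  ... | no none   = contradiction (sum-strict step u step<)
      (<-irrefl (trans (sym (*-distribʳ-sum (sum f) (λ i → 𝟙 (P? i))))
        (trans (cong (_* sum f) (sym (#-sum P?))) (*-distribˡ-sum (# P?) f))))
    where
    f : Fin n → ℕ
    f i = 𝟙 (P? i) * g i
    big : ∀ v → P v → sum f < # P? * g v
    big v pv = ≰⇒> λ le → none (v , pv , le)
    step : ∀ i → 𝟙 (P? i) * sum f ≤ # P? * f i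
    step i with P? i
    ... | yes p = ≤-trans (≤-reflexive (+-identityʳ _)) (≤-trans (<⇒≤ (big i p))
                    (≤-reflexive (cong (# P? *_) (sym (+-identityʳ (g i))))))
    ... | no _  = z≤n
    step< : 𝟙 (P? u) * sum f < # P? * f u
    step< rewrite 𝟙-yes (P? u) pu | +-identityʳ (sum f) | +-identityʳ (g u) = big u pu

-- Labelled paths and rainbow copies of path graphs.

data Path {V C : Set} (ℓ : V → V → C) : V → V → List V → List C → Set where
  [_] : ∀ a → Path ℓ a a (a ∷ []) []
  _∷_ : ∀ x {a b vs cs} → Path ℓ a b vs cs → Path ℓ x b (x ∷ vs) (ℓ x a ∷ cs)

module _ {V C : Set} {ℓ : V → V → C} where

  path-start : ∀ {a b vs cs} → Path ℓ a b vs cs → ∃ λ ws → vs ≡ a ∷ ws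
  path-start [ a ]   = [] , refl
  path-start (x ∷ p) = _ , refl

  path-end : ∀ {a b vs cs} → Path ℓ a b vs cs → b ∈ vs
  path-end [ a ]   = here refl
  path-end (x ∷ p) = there (path-end p)

  snoc : ∀ {a b vs cs} → Path ℓ a b vs cs → ∀ x → Path ℓ a x (vs ++ x ∷ []) (cs ++ ℓ b x ∷ [])
  snoc [ a ]   x = a ∷ [ x ]
  snoc (y ∷ p) x = y ∷ snoc p x

  path-length : ∀ {a b vs cs} → Path ℓ a b vs cs → length vs ≡ suc (length cs)
  path-length [ a ]   = refl
  path-length (x ∷ p) = cong suc (path-length p)

  edge-label : ∀ {a b vs cs} → Path ℓ a b vs cs → (i j : Fin (length vs)) → suc (toℕ i) ≡ toℕ j →
               ∃ λ k → toℕ k ≡ toℕ i × lookup cs k ≡ ℓ (lookup vs i) (lookup vs j)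
  edge-label [ a ] zero zero ()
  edge-label (x ∷ p) i j e with path-start p
  edge-label (x ∷ p) zero    (suc zero) e | ws , refl = zero , refl , refl
  edge-label (x ∷ p) (suc i) (suc j)    e | ws , refl with edge-label p i j (suc-injective e)
  ... | k , k≡i , e′ = suc k , cong suc k≡i , e′

lookup-injective : ∀ {A : Set} {xs : List A} → Unique xs → ∀ {i j} → lookup xs i ≡ lookup xs j → i ≡ j
lookup-injective (_ ∷ _)  {zero}  {zero}  _ = refl
lookup-injective (x∉ ∷ _) {zero}  {suc j} e = contradiction e (All.lookup x∉ (∈-lookup j))
lookup-injective (x∉ ∷ _) {suc i} {zero}  e = contradiction (sym e) (All.lookup x∉ (∈-lookup i))
lookup-injective (_ ∷ u)  {suc i} {suc j} e = cong suc (lookup-injective u e)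

∉⇒All : ∀ {A : Set} {x : A} {xs} → x ∉ xs → All (x ≢_) xs
∉⇒All = All.¬Any⇒All¬ _

unique-length : ∀ {n} {xs : List (Fin n)} → Unique xs → length xs ≤ n
unique-length {n} {xs} xs! = F.injective⇒≤ (lookup-injective xs!)

record RainbowPath {V C : Set} (ℓ : V → V → C) (t : ℕ) : Set where
  constructor rainbow
  field
    {from to}  : V
    {vertices} : List V
    {labels}   : List C
    path       : Path ℓ from to vertices labels
    vertices!  : Unique vertices
    labels!    : Unique labels
    long       : t ≤ length vertices

module _ {N B t : ℕ} {c : Colouring N} {f : Fin N → Fin N → Fin B}
         (f-sym : ∀ u v → f u v ≡ f v u)
         (c⇒f : ∀ u v u′ v′ → c u v ≡ c u′ v′ → f u v ≡ f u′ v′) where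

  -- An edge of the path graph is identified with the position of its lower end in the label list.
  -- Equal colours under `c` force equal labels under `f`, hence equal positions, hence the same
  -- edge.
  rainbowCopy : RainbowPath f t → RainbowCopy (PathGraph t) c
  rainbowCopy (rainbow {vertices = vs} {labels = cs} p vs! cs! long) = ψ , ψ-inj , distinct
    where
    -- Only the first `t` vertices of the path are used.
    ι : Fin t → Fin (length vs)
    ι i = inject≤ i long
    ψ : Fin t → Fin N
    ψ i = lookup vs (ι i)
    ψ-inj : Injective _≡_ _≡_ ψ
    ψ-inj e = F.inject≤-injective long long _ _ (lookup-injective vs! e)
    Place : Fin t → Fin t → Fin (length cs) → Set
    Place u v k = (toℕ k ≡ toℕ u × suc (toℕ u) ≡ toℕ v) ⊎ (toℕ k ≡ toℕ v × suc (toℕ v) ≡ toℕ u)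
    up : ∀ u v → suc (toℕ u) ≡ toℕ v → ∃ λ k → toℕ k ≡ toℕ u × lookup cs k ≡ f (ψ u) (ψ v)
    up u v e with edge-label p (ι u) (ι v) (trans (cong suc (F.toℕ-inject≤ u long)) (trans e (sym (F.toℕ-inject≤ v long))))
    ... | k , k≡ , col = k , trans k≡ (F.toℕ-inject≤ u long) , col
    place : ∀ u v → T (PathGraph t u v) → ∃ λ k → lookup cs k ≡ f (ψ u) (ψ v) × Place u v k
    place u v h with Equivalence.to T-∨ h
    ... | inj₁ e = let e′ = ≡ᵇ⇒≡ _ _ e ; k , k≡ , col = up u v e′ in k , col , inj₁ (k≡ , e′)
    ... | inj₂ e = let e′ = ≡ᵇ⇒≡ _ _ e ; k , k≡ , col = up v u e′ in
                   k , trans col (f-sym _ _) , inj₂ (k≡ , e′)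
    same : ∀ {u v u′ v′} k → Place u v k → Place u′ v′ k → (u ≡ u′ × v ≡ v′) ⊎ (u ≡ v′ × v ≡ u′)
    same k (inj₁ (a , b)) (inj₁ (a′ , b′)) = inj₁ (F.toℕ-injective u≡ , F.toℕ-injective (trans (sym b) (trans (cong suc u≡) b′)))
      where u≡ = trans (sym a) a′
    same k (inj₁ (a , b)) (inj₂ (a′ , b′)) = inj₂ (F.toℕ-injective u≡ , F.toℕ-injective (trans (sym b) (trans (cong suc u≡) b′)))
      where u≡ = trans (sym a) a′
    same k (inj₂ (a , b)) (inj₁ (a′ , b′)) = inj₂ (F.toℕ-injective (trans (sym b) (trans (cong suc v≡) b′)) , F.toℕ-injective v≡)
      where v≡ = trans (sym a) a′
    same k (inj₂ (a , b)) (inj₂ (a′ , b′)) = inj₁ (F.toℕ-injective (trans (sym b) (trans (cong suc v≡) b′)) , F.toℕ-injective v≡)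
      where v≡ = trans (sym a) a′
    distinct : ∀ u v u′ v′ → T (PathGraph t u v) → T (PathGraph t u′ v′) →
               c (ψ u) (ψ v) ≡ c (ψ u′) (ψ v′) → (u ≡ u′ × v ≡ v′) ⊎ (u ≡ v′ × v ≡ u′)
    distinct u v u′ v′ h h′ e with place u v h | place u′ v′ h′
    ... | k , col , pl | k′ , col′ , pl′
      with refl ← lookup-injective cs! (trans col (trans (c⇒f _ _ _ _ e) (sym col′))) = same k pl pl′

-- Building a tree leaf by leaf.

module Tree {s : ℕ} (S : Graph s) where

  -- A construction order with the newest vertex first. The last argument of `leaf` makes the parent
  -- the only earlier neighbour, so a greedy embedding has one adjacency to respect at each stage.
  data Grown : List (Fin s) → Set where
    root : ∀ r → Grown (r ∷ [])
    leaf : ∀ {xs} w p → Grown xs → p ∈ xs → w ∉ xs → S p w ≡ true →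
           (∀ q → q ∈ xs → S q w ≡ true → q ≡ p) → Grown (w ∷ xs)

  grown! : ∀ {xs} → Grown xs → Unique xs
  grown! (root r)               = [] ∷ []
  grown! (leaf w p g _ w∉ _ _) = ∉⇒All w∉ ∷ grown! g

  module _ (simple : IsSimple S) where

    S-sym : ∀ {u v} → S u v ≡ true → S v u ≡ true
    S-sym {u} {v} e = trans (proj₁ simple v u) e

    record Link (p q : Fin s) (xs : List (Fin s)) : Set where
      field
        {inner}   : List (Fin s)
        {edges}   : List Bool
        route     : Path S p q inner edges
        inner!    : Unique inner
        inner⊆    : ∀ {x} → x ∈ inner → x ∈ xs
        adjacent  : All (_≡ true) edges

    link : ∀ {xs p q} → Grown xs → p ∈ xs → q ∈ xs → Link p q xs
    link (root r) (here refl) (here refl) = record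
      { route = [ r ] ; inner! = [] ∷ [] ; inner⊆ = λ x → x ; adjacent = [] }
    link (leaf w p g p∈ w∉ e _) (here refl) (here refl) = record
      { route = [ w ] ; inner! = [] ∷ [] ; inner⊆ = λ { (here e) → here e } ; adjacent = [] }
    link (leaf w p g p∈ w∉ e _) (here refl) (there q∈) = record
      { route = w ∷ route ; inner! = ∉⇒All (w∉ ∘ inner⊆) ∷ inner!
      ; inner⊆ = λ { (here e) → here e ; (there x) → there (inner⊆ x) } ; adjacent = S-sym e ∷ adjacent }
      where open Link (link g p∈ q∈)
    link (leaf w p g p∈ w∉ e _) (there q∈) (here refl) = record
      { route = snoc route w
      ; inner! = Unique.++⁺ inner! ([] ∷ []) λ { (x∈ , here refl) → w∉ (inner⊆ x∈) }
      ; inner⊆ = λ x∈ → [ there ∘ inner⊆ , (λ { (here e) → here e }) ]′ (∈-++⁻ inner x∈)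
      ; adjacent = All.++⁺ adjacent (e ∷ []) }
      where open Link (link g q∈ p∈)
    link (leaf w p g p∈ w∉ e _) (there q∈) (there q′∈) = record
      { route = route ; inner! = inner! ; inner⊆ = there ∘ inner⊆ ; adjacent = adjacent }
      where open Link (link g q∈ q′∈)

    consecutive : ∀ {p q x xs es} → Path S p q (x ∷ xs) es → All (_≡ true) es → (i : Fin (length xs)) →
                  T (S (lookup (x ∷ xs) (inject₁ i)) (lookup (x ∷ xs) (suc i)))
    consecutive (x ∷ r) (e ∷ es) i with path-start r
    consecutive (x ∷ r) (e ∷ es) zero    | ws , refl = Equivalence.from T-≡ e
    consecutive (x ∷ r) (e ∷ es) (suc i) | ws , refl = consecutive r es i

    last-vertex : ∀ {p q x xs es} → Path S p q (x ∷ xs) es → lookup (x ∷ xs) (fromℕ (length xs)) ≡ q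
    last-vertex [ a ] = refl
    last-vertex (x ∷ r) with path-start r
    ... | ws , refl = last-vertex r

    -- The path between `p` and `q` inside the grown part closes up through `w`; as `p` and `q`
    -- differ, the cycle has at least three vertices.
    second-neighbour⇒cycle : ∀ {xs w p q} → Grown xs → p ∈ xs → q ∈ xs → w ∉ xs → p ≢ q →
                             S p w ≡ true → S q w ≡ true → HasCycle S
    second-neighbour⇒cycle {w = w} g p∈ q∈ w∉ p≢q pw qw =
      length inner , two route , lookup (w ∷ inner) , lookup-injective (∉⇒All (w∉ ∘ inner⊆) ∷ inner!) ,
      consecutive around (S-sym pw ∷ adjacent) ,
      Equivalence.from T-≡ (trans (cong (λ x → S x w) (last-vertex around)) qw)
      where
      open Link (link g p∈ q∈)
      around = w ∷ route
      two : ∀ {vs es} → Path S _ _ vs es → 2 ≤ length vs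
      two [ a ] = contradiction refl p≢q
      two (x ∷ r) with path-start r
      ... | ws , refl = s≤s (s≤s z≤n)

    -- The first step of the walk that leaves `xs` is the required edge.
    crossing : ∀ {xs} m (w : Fin (suc m) → Fin s) → w zero ∈ xs → w (fromℕ m) ∉ xs →
               (∀ i → T (S (w (inject₁ i)) (w (suc i)))) →
               ∃ λ p → ∃ λ q → p ∈ xs × q ∉ xs × S p q ≡ true
    crossing zero    w w₀∈ wₘ∉ edge = contradiction w₀∈ wₘ∉
    crossing {xs} (suc m) w w₀∈ wₘ∉ edge with w (suc zero) ∈? xs
    ... | yes w₁∈ = crossing m (w ∘ suc) w₁∈ wₘ∉ (edge ∘ suc)
    ... | no w₁∉  = w zero , w (suc zero) , w₀∈ , w₁∉ , Equivalence.to T-≡ (edge zero)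

    -- Connectedness supplies an edge leaving the grown part, and acyclicity makes its outer end a
    -- leaf. The fuel bounds the number of missing vertices.
    grow : Connected S → Acyclic S → ∀ fuel {xs} → Grown xs → s ∸ length xs ≤ fuel →
           ∃ λ ys → Grown ys × ∀ v → v ∈ ys
    grow conn acyc fuel {xs} g le with F.all? (_∈? xs)
    ... | yes all∈ = xs , g , all∈
    ... | no ¬all∈ with F.¬∀⟶∃¬ s (_∈ xs) (_∈? xs) ¬all∈
    ... | v , v∉ with first g
      where
      first : ∀ {xs} → Grown xs → ∃ (_∈ xs)
      first (root r) = r , here refl
      first (leaf w _ _ _ _ _ _) = w , here refl
    ... | r , r∈ with conn r v
    ... | m , w , w₀ , wₘ , edge with crossing m w (subst (_∈ xs) (sym w₀) r∈) (λ h → v∉ (subst (_∈ xs) wₘ h)) edge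
    ... | p , q , p∈ , q∉ , pq = continue fuel le
      where
      unique-parent : ∀ q′ → q′ ∈ xs → S q′ q ≡ true → q′ ≡ p
      unique-parent q′ q′∈ e with q′ F.≟ p
      ... | yes eq = eq
      ... | no q′≢p = contradiction (second-neighbour⇒cycle g q′∈ p∈ q∉ q′≢p e pq) acyc
      g′ : Grown (q ∷ xs)
      g′ = leaf q p g p∈ q∉ pq unique-parent
      room : length (q ∷ xs) ≤ s
      room = unique-length (grown! g′)
      continue : ∀ fuel → s ∸ length xs ≤ fuel → ∃ λ ys → Grown ys × ∀ v → v ∈ ys
      continue zero    le = contradiction (m∸n≡0⇒m≤n (n≤0⇒n≡0 le)) (<⇒≱ room)
      continue (suc fuel) le = grow conn acyc fuel g′
        (≤-pred (≤-trans (≤-reflexive (sym (+-∸-assoc 1 room))) le))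

    tree-order : Connected S → Acyclic S → Fin s → ∃ λ ys → Grown ys × ∀ v → v ∈ ys
    tree-order conn acyc r = grow conn acyc _ (root r) ≤-refl

-- Degeneracy: a core of large minimum degree or a degenerate ordering.

module _ {N : ℕ} {G : Fin N → Fin N → Set} (G? : Decidable G) (n : ℕ) where

  record Core : Set₁ where
    field
      {U}    : Fin N → Set
      U?     : Decidable₁ U
      point  : ∃ U
      degree : ∀ v → U v → n ≤ # (λ w → U? w ×-dec G? v w)

  -- A degeneracy ordering, with the vertices deleted first at the bottom.
  record Ranking : Set where
    field
      rank           : Fin N → ℕ
      rank-injective : ∀ {u v} → rank u ≡ rank v → u ≡ v
      few-above      : ∀ v → # (λ w → G? v w ×-dec (rank v <? rank w)) < n

  private
    record RankingOn (U : Fin N → Set) (U? : Decidable₁ U) : Set where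
      field
        r     : Fin N → ℕ
        r-inj : ∀ {u v} → U u → U v → r u ≡ r v → u ≡ v
        few   : ∀ v → U v → # (λ w → (U? w ×-dec G? v w) ×-dec (r v <? r w)) < n

    -- Vertices of degree less than `n` are deleted one at a time. If the process stops at a
    -- nonempty set, that set is a core; if it exhausts the set, the order of deletion is a ranking.
    peelFrom : ∀ fuel {U} (U? : Decidable₁ U) → # U? ≤ fuel → Core ⊎ RankingOn U U?
    peelFrom fuel {U} U? le with F.any? (λ v → U? v ×-dec (# (λ w → U? w ×-dec G? v w) <? n))
    ... | yes (v , uv , small) = remove fuel le
      where
      V? : Decidable₁ (λ w → U w × w ≢ v)
      V? w = U? w ×-dec ¬? (w F.≟ v)
      fewer : # V? < # U?
      fewer = #-strict (λ w → proj₁) V? U? v (λ h → proj₂ h refl) uv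
      remove : ∀ fuel → # U? ≤ fuel → Core ⊎ RankingOn U U?
      remove zero le = contradiction (≤-trans fewer le) λ ()
      remove (suc fuel) le with peelFrom fuel V? (≤-pred (≤-trans fewer le))
      ... | inj₁ core = inj₁ core
      ... | inj₂ R = inj₂ (record { r = r′ ; r-inj = inj ; few = few′ })
        where
        open RankingOn R
        -- The deleted vertex goes below all others: every neighbour still present may then lie
        -- above it, and there are fewer than `n` of these.
        r′ : Fin N → ℕ
        r′ w with w F.≟ v
        ... | yes _ = 0
        ... | no _  = suc (r w)
        inj : ∀ {a b} → U a → U b → r′ a ≡ r′ b → a ≡ b
        inj {a} {b} ua ub e with a F.≟ v | b F.≟ v
        ... | yes refl | yes refl = refl
        ... | no a≢ | no b≢ = r-inj (ua , a≢) (ub , b≢) (suc-injective e)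
        few′ : ∀ a → U a → # (λ w → (U? w ×-dec G? a w) ×-dec (r′ a <? r′ w)) < n
        few′ a ua with a F.≟ v
        ... | yes refl = ≤-<-trans (#-mono (λ _ → proj₁)
                (λ w → (U? w ×-dec G? a w) ×-dec (0 <? r′ w)) (λ w → U? w ×-dec G? a w)) small
        ... | no a≢ = ≤-<-trans (#-mono shrink
                (λ w → (U? w ×-dec G? a w) ×-dec (suc (r a) <? r′ w))
                (λ w → (V? w ×-dec G? a w) ×-dec (r a <? r w))) (few a (ua , a≢))
          where
          shrink : ∀ w → (U w × G a w) × suc (r a) < r′ w → ((U w × w ≢ v) × G a w) × r a < r w
          shrink w ((uw , g) , lt) with w F.≟ v
          ... | no w≢ = ((uw , w≢) , g) , ≤-pred lt
    ... | no none with F.any? U?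
    ... | yes point = inj₁ (record { U? = U? ; point = point
                                   ; degree = λ v uv → ≮⇒≥ λ lt → none (v , uv , lt) })
    ... | no empty = inj₂ (record { r = λ _ → 0 ; r-inj = λ {u} uu → contradiction (u , uu) empty
                                  ; few = λ v uv → contradiction (v , uv) empty })

    all? : Decidable₁ {A = Fin N} (λ _ → ⊤)
    all? _ = yes tt

  -- Applied twice: to each colour class with `n = s`, where a core contains the tree, and to the
  -- graph of entangled pairs with `n = t`, where a core contains a rainbow path.
  peel : Core ⊎ Ranking
  peel with peelFrom N all? (#≤n all?)
  ... | inj₁ core = inj₁ core
  ... | inj₂ R = inj₂ (record { rank = r ; rank-injective = r-inj _ _
                              ; few-above = λ v → ≤-<-trans (#-mono (λ { _ (g , lt) → (_ , g) , lt }) _ _) (few v _) })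
    where open RankingOn R

  module _ (G-sym : ∀ {u v} → G u v → G v u) (core : Core) {S : Graph n} (simple : IsSimple S) where
    open Core core
    open Tree S

    private
      -- `φ` is a total function for convenience; its values outside `xs` carry no information.
      record Embedding (xs : List (Fin n)) : Set where
        field
          φ     : Fin n → Fin N
          φ-inj : ∀ {u v} → u ∈ xs → v ∈ xs → φ u ≡ φ v → u ≡ v
          φ∈U   : ∀ {u} → u ∈ xs → U (φ u)
          edge  : ∀ {u v} → u ∈ xs → v ∈ xs → S u v ≡ true → G (φ u) (φ v)

      loopless : ∀ {u} → S u u ≢ true
      loopless {u} e with trans (sym e) (proj₂ simple u)
      ... | ()

      -- The image of the parent has at least `n` neighbours in the core, while fewer than `n`
      -- vertices are occupied, so the new leaf finds a free place.
      embedGrown : ∀ {xs} → Grown xs → Embedding xs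
      embedGrown (root r) = record
        { φ = λ _ → proj₁ point
        ; φ-inj = λ { (here refl) (here refl) _ → refl }
        ; φ∈U = λ _ → proj₂ point
        ; edge = λ { (here refl) (here refl) e → contradiction e loopless } }
      embedGrown {w ∷ xs} g′@(leaf w p g p∈ w∉ pw only) with embedGrown g
      ... | E with pick (λ y → U? y ×-dec G? (Embedding.φ E p) y) (_∈? map (Embedding.φ E) xs)
                  (≤-<-trans (≤-trans (#-∈ (map (Embedding.φ E) xs)) (≤-reflexive (length-map _ xs)))
                    (<-≤-trans (unique-length (grown! g′)) (degree _ (Embedding.φ∈U E p∈))))
      ... | y , (uy , gpy) , y∉ = record { φ = φ′ ; φ-inj = inj ; φ∈U = inU ; edge = edge′ }
        where
        open Embedding E
        φ′ : Fin n → Fin N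
        φ′ v with v F.≟ w
        ... | yes _ = y
        ... | no _  = φ v
        φ′-new : φ′ w ≡ y
        φ′-new with w F.≟ w
        ... | yes _ = refl
        ... | no w≢ = contradiction refl w≢
        φ′-old : ∀ {v} → v ∈ xs → φ′ v ≡ φ v
        φ′-old {v} v∈ with v F.≟ w
        ... | yes refl = contradiction v∈ w∉
        ... | no _ = refl
        fresh : ∀ {v} → v ∈ xs → φ′ v ≢ φ′ w
        fresh v∈ e = y∉ (subst (_∈ map φ xs) (trans (sym (φ′-old v∈)) (trans e φ′-new)) (∈-map⁺ φ v∈))
        inj : ∀ {u v} → u ∈ w ∷ xs → v ∈ w ∷ xs → φ′ u ≡ φ′ v → u ≡ v
        inj (here refl) (here refl) e = refl
        inj (here refl) (there v∈) e = contradiction (sym e) (fresh v∈)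
        inj (there u∈) (here refl) e = contradiction e (fresh u∈)
        inj (there u∈) (there v∈) e = φ-inj u∈ v∈ (trans (sym (φ′-old u∈)) (trans e (φ′-old v∈)))
        inU : ∀ {u} → u ∈ w ∷ xs → U (φ′ u)
        inU (here refl) = subst U (sym φ′-new) uy
        inU (there u∈) = subst U (sym (φ′-old u∈)) (φ∈U u∈)
        up : ∀ {u} → u ∈ xs → S u w ≡ true → G (φ′ u) (φ′ w)
        up u∈ e with only _ u∈ e
        ... | refl = subst₂ G (sym (φ′-old u∈)) (sym φ′-new) gpy
        edge′ : ∀ {u v} → u ∈ w ∷ xs → v ∈ w ∷ xs → S u v ≡ true → G (φ′ u) (φ′ v)
        edge′ (here refl) (here refl) e = contradiction e loopless
        edge′ (here refl) (there v∈) e = G-sym (up v∈ (S-sym simple e))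
        edge′ (there u∈) (here refl) e = up u∈ e
        edge′ (there u∈) (there v∈) e = subst₂ G (sym (φ′-old u∈)) (sym (φ′-old v∈)) (edge u∈ v∈ e)

    embedTree : ∀ {xs} → Grown xs → (∀ v → v ∈ xs) →
                ∃ λ (φ : Fin n → Fin N) → Injective _≡_ _≡_ φ × ∀ u v → S u v ≡ true → G (φ u) (φ v)
    embedTree g all = φ , φ-inj (all _) (all _) , λ u v → edge (all u) (all v)
      where open Embedding (embedGrown g)

-- Cherries and lexical vertices.

-- Lex w v stands for: v ⟶ w, and this edge has the colour assigned to the vertex w.
IsLexical : ∀ {N} {Lex : Fin N → Fin N → Set} → Decidable Lex → Fin N → Set
IsLexical {N} lex? w = N ≤ 5 * # (lex? w)

module Lexical {N B s t : ℕ} (1≤s : 1 ≤ s)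
  {f : Fin N → Fin N → Fin B} (f-sym : ∀ u v → f u v ≡ f v u)
  {_⟶_ : Fin N → Fin N → Set} (_⟶?_ : Decidable _⟶_)
  (total : ∀ {u v} → u ≢ v → u ⟶ v ⊎ v ⟶ u)
  (outdegree : ∀ v γ → # (λ w → (v ⟶? w) ×-dec (f v w F.≟ γ)) ≤ s)
  where

  cherry? : ∀ v v′ w → Dec (v ⟶ w × v′ ⟶ w × f v w ≢ f v′ w)
  cherry? v v′ w = (v ⟶? w) ×-dec (v′ ⟶? w) ×-dec ¬? (f v w F.≟ f v′ w)

  cherries : Fin N → Fin N → ℕ
  cherries v v′ = # (cherry? v v′)

  -- The threshold covers all middle vertices that a path with fewer than `t` vertices can block: at
  -- most `t` through vertices already in use, and at most `s * t` for each of the two ends through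
  -- labels already in use.
  Entangled : Fin N → Fin N → Set
  Entangled v v′ = 3 * (s * t) < cherries v v′

  Entangled? : Decidable Entangled
  Entangled? v v′ = _ <? _

  out-colours : ∀ v γs → # (λ w → (v ⟶? w) ×-dec (f v w ∈? γs)) ≤ s * length γs
  out-colours v = #-colours (v ⟶?_) (f v) (outdegree v)

  -- The path alternates between vertices of the core and middle vertices of cherries.
  core⇒rainbow : Core Entangled? t → RainbowPath f t
  core⇒rainbow core = extend t (proj₂ point) [ proj₁ point ] ([] ∷ []) [] (m∸n≤m t 1)
    where
    open Core core
    extend : ∀ fuel {v b vs cs} → U v → Path f v b vs cs → Unique vs → Unique cs →
             t ∸ length vs ≤ fuel → RainbowPath f t
    extend fuel {v} {b} {vs} {cs} uv p vs! cs! le with t ≤? length vs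
    ... | yes long = rainbow p vs! cs! long
    ... | no short with pick (λ w → U? w ×-dec Entangled? v w) (_∈? vs)
                         (≤-<-trans (#-∈ vs) (<-≤-trans (≰⇒> short) (degree v uv)))
    ... | v′ , (uv′ , linked) , v′∉ with pick (cherry? v v′) blocked? (≤-<-trans few linked)
      where
      in-colours? : ∀ w → Dec ((v ⟶ w × f v w ∈ cs) ⊎ (v′ ⟶ w × f v′ w ∈ cs))
      in-colours? w = ((v ⟶? w) ×-dec (f v w ∈? cs)) ⊎-dec ((v′ ⟶? w) ×-dec (f v′ w ∈? cs))
      blocked? : ∀ w → Dec (w ∈ v′ ∷ vs ⊎ ((v ⟶ w × f v w ∈ cs) ⊎ (v′ ⟶ w × f v′ w ∈ cs)))
      blocked? w = (w ∈? (v′ ∷ vs)) ⊎-dec in-colours? w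
      cs≤t : length cs ≤ t
      cs≤t = ≤-trans (n≤1+n _) (≤-trans (≤-reflexive (sym (path-length p))) (<⇒≤ (≰⇒> short)))
      few : # blocked? ≤ 3 * (s * t)
      few = begin
        # blocked? ≤⟨ #-⊎ (λ _ h → h) blocked? (_∈? (v′ ∷ vs)) in-colours? ⟩
        # (_∈? (v′ ∷ vs)) + # in-colours?
          ≤⟨ +-mono-≤ (#-∈ (v′ ∷ vs)) (#-⊎ (λ _ h → h) in-colours?
                                         (λ w → (v ⟶? w) ×-dec (f v w ∈? cs))
                                         (λ w → (v′ ⟶? w) ×-dec (f v′ w ∈? cs))) ⟩
        suc (length vs) + (# (λ w → (v ⟶? w) ×-dec (f v w ∈? cs)) + # (λ w → (v′ ⟶? w) ×-dec (f v′ w ∈? cs)))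
          ≤⟨ +-mono-≤ (≰⇒> short) (+-mono-≤ (out-colours v cs) (out-colours v′ cs)) ⟩
        t + (s * length cs + s * length cs)
          ≤⟨ +-mono-≤ (m≤n*m t s ⦃ >-nonZero 1≤s ⦄) (+-mono-≤ (*-monoʳ-≤ s cs≤t) (*-monoʳ-≤ s cs≤t)) ⟩
        s * t + (s * t + s * t) ≡⟨ cong (λ z → s * t + (s * t + z)) (sym (+-identityʳ (s * t))) ⟩
        3 * (s * t) ∎
        where open ≤-Reasoning
    ... | w , (vw , v′w , diff) , free =
      next fuel le
      where
      w∉ : w ∉ v′ ∷ vs
      w∉ = free ∘ inj₁
      wv≡ = f-sym w v
      wv∉ : f w v ∉ cs
      wv∉ h = free (inj₂ (inj₁ (vw , subst (_∈ cs) wv≡ h)))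
      v′w∉ : f v′ w ∉ f w v ∷ cs
      v′w∉ (here e) = diff (trans (sym wv≡) (sym e))
      v′w∉ (there h) = free (inj₂ (inj₂ (v′w , h)))
      v′∉′ : v′ ∉ w ∷ vs
      v′∉′ (here refl) = w∉ (here refl)
      v′∉′ (there h) = v′∉ h
      next : ∀ fuel → t ∸ length vs ≤ fuel → RainbowPath f t
      next zero le = contradiction (m∸n≡0⇒m≤n (n≤0⇒n≡0 le)) short
      next (suc fuel) le = extend fuel uv′ (v′ ∷ w ∷ p) (∉⇒All v′∉′ ∷ ∉⇒All (w∉ ∘ there) ∷ vs!)
        (∉⇒All v′w∉ ∷ ∉⇒All wv∉ ∷ cs!)
        (≤-trans (∸-monoʳ-≤ t (n≤1+n (suc (length vs)))) (≤-pred (≤-trans (≤-reflexive (sym (+-∸-assoc 1 (≰⇒> short)))) le)))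

  Entangled-sym : ∀ {v v′} → Entangled v v′ → Entangled v′ v
  Entangled-sym {v} {v′} h = <-≤-trans h (#-mono (λ w (a , b , d) → b , a , d ∘ sym) (cherry? v v′) (cherry? v′ v))

  Entangled-irrefl : ∀ v → ¬ Entangled v v
  Entangled-irrefl v h with #-nonempty (cherry? v v) (≤-<-trans z≤n h)
  ... | w , _ , _ , d = d refl

  module _ (ranking : Ranking Entangled? t) where
    open Ranking ranking

    -- An entangled pair is counted once from its lower and once from its higher end, and each
    -- vertex has fewer than `t` partners above it.
    few-links : sum (λ v → # (Entangled? v)) ≤ 2 * (N * t)
    few-links = begin
      sum (λ v → # (Entangled? v)) ≤⟨ sum-mono (λ v → #-⊎ (split v) (Entangled? v) (up v) (down v)) ⟩
      sum (λ v → # (up v) + # (down v)) ≡⟨ ∑-distrib-+ (λ v → # (up v)) (λ v → # (down v)) ⟩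
      sum (λ v → # (up v)) + sum (λ v → # (down v)) ≡⟨ cong (sum (λ v → # (up v)) +_) (#-swap down) ⟩
      sum (λ v → # (up v)) + sum (λ v′ → # (λ v → down v v′))
        ≤⟨ +-mono-≤ (sum-≤-const λ v → <⇒≤ (few-above v))
             (sum-≤-const λ v′ → ≤-trans (#-mono (λ v (h , lt) → Entangled-sym h , lt) (λ v → down v v′) (up v′)) (<⇒≤ (few-above v′))) ⟩
      N * t + N * t ≡⟨ cong (N * t +_) (sym (+-identityʳ (N * t))) ⟩
      2 * (N * t) ∎
      where
      open ≤-Reasoning
      up : ∀ v v′ → Dec (Entangled v v′ × rank v < rank v′)
      up v v′ = Entangled? v v′ ×-dec (rank v <? rank v′)
      down : ∀ v v′ → Dec (Entangled v v′ × rank v′ < rank v)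
      down v v′ = Entangled? v v′ ×-dec (rank v′ <? rank v)
      split : ∀ v v′ → Entangled v v′ →
              (Entangled v v′ × rank v < rank v′) ⊎ (Entangled v v′ × rank v′ < rank v)
      split v v′ h with <-cmp (rank v) (rank v′)
      ... | tri< lt _ _ = inj₁ (h , lt)
      ... | tri> _ _ gt = inj₂ (h , gt)
      ... | tri≈ _ eq _ with rank-injective eq
      ... | refl = contradiction h (Entangled-irrefl v)

    differing? : ∀ v w v′ → Dec (v′ ⟶ w × f v w ≢ f v′ w)
    differing? v w v′ = (v′ ⟶? w) ×-dec ¬? (f v w F.≟ f v′ w)

    -- The number of cherries with middle vertex `w`, as ordered pairs of differently coloured edges
    -- into `w`.
    Δ : Fin N → ℕ
    Δ w = sum (λ v → 𝟙 (v ⟶? w) * # (differing? v w))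

    -- Cherries are counted by their pairs of outer vertices. A pair that is not entangled
    -- contributes at most `3 * (s * t)`, an entangled one at most `N`, and by `few-links` there are
    -- at most `2 * (N * t)` of the latter.
    few-cherries : sum Δ ≤ N * (N * (5 * (s * t)))
    few-cherries = begin
      sum Δ ≡⟨ sum-cong-≋ (λ w → sum-cong-≋ λ v → sym (#-guard-≡ (v ⟶? w) (differing? v w))) ⟩
      sum (λ w → sum λ v → # (λ v′ → cherry? v v′ w)) ≡⟨ ∑-comm (λ w v → # (λ v′ → cherry? v v′ w)) ⟩
      sum (λ v → sum λ w → # (λ v′ → cherry? v v′ w)) ≡⟨ sum-cong-≋ (λ v → #-swap (λ w v′ → cherry? v v′ w)) ⟩
      sum (λ v → sum λ v′ → cherries v v′) ≤⟨ sum-mono (λ v → sum-mono λ v′ → bound v v′) ⟩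
      sum (λ v → sum λ v′ → 3 * (s * t) + N * 𝟙 (Entangled? v v′))
        ≡⟨ sum-cong-≋ (λ v → trans (∑-distrib-+ (λ _ → 3 * (s * t)) (λ v′ → N * 𝟙 (Entangled? v v′)))
             (cong₂ _+_ (sum-const N _) (trans (sym (*-distribˡ-sum N (λ v′ → 𝟙 (Entangled? v v′)))) (cong (N *_) (sym (#-sum (Entangled? v))))))) ⟩
      sum (λ v → N * (3 * (s * t)) + N * # (Entangled? v))
        ≡⟨ trans (∑-distrib-+ (λ _ → N * (3 * (s * t))) (λ v → N * # (Entangled? v)))
             (cong₂ _+_ (sum-const N _) (sym (*-distribˡ-sum N (λ v → # (Entangled? v))))) ⟩
      N * (N * (3 * (s * t))) + N * sum (λ v → # (Entangled? v)) ≤⟨ +-monoʳ-≤ _ (*-monoʳ-≤ N few-links) ⟩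
      N * (N * (3 * (s * t))) + N * (2 * (N * t))
        ≤⟨ +-monoʳ-≤ _ (*-monoʳ-≤ N (*-monoʳ-≤ 2 (*-monoʳ-≤ N (m≤n*m t s ⦃ >-nonZero 1≤s ⦄)))) ⟩
      N * (N * (3 * (s * t))) + N * (2 * (N * (s * t))) ≡⟨ arith N (s * t) ⟩
      N * (N * (5 * (s * t))) ∎
      where
      open ≤-Reasoning
      arith : ∀ n x → n * (n * (3 * x)) + n * (2 * (n * x)) ≡ n * (n * (5 * x))
      arith = solve-∀
      bound : ∀ v v′ → cherries v v′ ≤ 3 * (s * t) + N * 𝟙 (Entangled? v v′)
      bound v v′ = ≤-trans (𝟙-bound (Entangled? v v′) N (3 * (s * t))
        (λ _ → ≤-trans (#≤n (cherry? v v′)) (≤-trans (≤-reflexive (sym (*-identityʳ N))) (m≤m+n _ _)))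
        ≮⇒≥) (≤-reflexive (+-comm (N * 𝟙 (Entangled? v v′)) (3 * (s * t))))

    indegree : Fin N → ℕ
    indegree w = # (_⟶? w)

    opaque
      -- Some in-edge of `w` differs in colour from at most the average number of in-edges; its
      -- colour is taken.
      popular : ∀ w → ∃ λ γ → indegree w * # (λ v → (v ⟶? w) ×-dec ¬? (γ F.≟ f v w)) ≤ Δ w
      popular w with F.any? (_⟶? w)
      ... | yes point with average (_⟶? w) (λ v → # (differing? v w)) point
      ... | v , _ , le = f v w , le
      -- Without in-edges any colour will do, and `f w w` is at hand.
      popular w | no none rewrite #-empty (_⟶? w) (λ v h → none (v , h)) = f w w , z≤n

    colour : Fin N → Fin B
    colour w = proj₁ (popular w)

    lex? : ∀ w v → Dec (v ⟶ w × f v w ≡ colour w)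
    lex? w v = (v ⟶? w) ×-dec (f v w F.≟ colour w)

    lexical? : Decidable₁ (IsLexical lex?)
    lexical? w = _ ≤? _

    -- If the indegree is at most `N / 4`, the first summand suffices. Otherwise fewer than `N / 5`
    -- in-edges have the popular colour, so at least `N / 20` have another one, and `popular` gives
    -- at least indegree times that many cherries at `w`; the factor 320 is 4 · 4 · 20.
    not-lexical : ∀ w → ¬ IsLexical lex? w → 4 * N * indegree w ≤ N * N + 320 * Δ w
    not-lexical w few with 4 * indegree w ≤? N
    ... | yes small = begin
      4 * N * indegree w ≡⟨ arith N (indegree w) ⟩
      N * (4 * indegree w) ≤⟨ *-monoʳ-≤ N small ⟩
      N * N ≤⟨ m≤m+n (N * N) _ ⟩
      N * N + 320 * Δ w ∎
      where
      open ≤-Reasoning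
      arith : ∀ n i → 4 * n * i ≡ n * (4 * i)
      arith = solve-∀
    ... | no large = begin
      4 * N * i ≤⟨ *-monoʳ-≤ (4 * N) (#≤n (_⟶? w)) ⟩
      4 * N * N ≡⟨ *-assoc 4 N N ⟩
      4 * (N * N) ≤⟨ *-monoʳ-≤ 4 (*-mono-≤ (<⇒≤ (≰⇒> large)) N≤20n) ⟩
      4 * ((4 * i) * (20 * n)) ≡⟨ arith i n ⟩
      320 * (i * n) ≤⟨ *-monoʳ-≤ 320 (proj₂ (popular w)) ⟩
      320 * Δ w ≤⟨ m≤n+m _ (N * N) ⟩
      N * N + 320 * Δ w ∎
      where
      open ≤-Reasoning
      i = indegree w
      n = # (λ v → (v ⟶? w) ×-dec ¬? (colour w F.≟ f v w))
      ℓ = # (lex? w)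
      arith : ∀ i n → 4 * ((4 * i) * (20 * n)) ≡ 320 * (i * n)
      arith = solve-∀
      i≤ : i ≤ ℓ + n
      i≤ = #-⊎ cases (_⟶? w) (lex? w) (λ v → (v ⟶? w) ×-dec ¬? (colour w F.≟ f v w))
        where
        cases : ∀ v → v ⟶ w → (v ⟶ w × f v w ≡ colour w) ⊎ (v ⟶ w × colour w ≢ f v w)
        cases v h with colour w F.≟ f v w
        ... | yes e = inj₁ (h , sym e)
        ... | no ne = inj₂ (h , ne)
      N≤20n : N ≤ 20 * n
      N≤20n = +-cancelˡ-≤ (4 * N) N (20 * n) (begin
        4 * N + N ≡⟨ lem₁ N ⟩
        5 * N ≤⟨ *-monoʳ-≤ 5 (<⇒≤ (≰⇒> large)) ⟩
        5 * (4 * i) ≤⟨ *-monoʳ-≤ 5 (*-monoʳ-≤ 4 i≤) ⟩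
        5 * (4 * (ℓ + n)) ≡⟨ lem₂ ℓ n ⟩
        4 * (5 * ℓ) + 20 * n ≤⟨ +-monoˡ-≤ (20 * n) (*-monoʳ-≤ 4 (<⇒≤ (≰⇒> few))) ⟩
        4 * N + 20 * n ∎)
        where
        lem₁ : ∀ n → 4 * n + n ≡ 5 * n
        lem₁ = solve-∀
        lem₂ : ∀ ℓ n → 5 * (4 * (ℓ + n)) ≡ 4 * (5 * ℓ) + 20 * n
        lem₂ = solve-∀

    pointwise : ∀ w → 4 * N * indegree w ≤ 4 * N * N * 𝟙 (lexical? w) + (N * N + 320 * Δ w)
    pointwise w = 𝟙-bound (lexical? w) (4 * N * N) (N * N + 320 * Δ w)
      (λ _ → ≤-trans (*-monoʳ-≤ (4 * N) (#≤n (_⟶? w))) (≤-trans (≤-reflexive (sym (*-identityʳ _))) (m≤m+n _ _)))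
      (not-lexical w)

    -- Every `w` is joined to each of the other `N - 1` vertices in at least one direction, and
    -- indegrees and outdegrees have the same sum.
    many-edges : N * N ≤ 2 * sum indegree + N
    many-edges = begin
      N * N ≡⟨ sym (sum-const N N) ⟩
      sum {N} (λ _ → N) ≤⟨ sum-mono (λ w → all-but-one w) ⟩
      sum (λ w → (indegree w + # (w ⟶?_)) + 1) ≡⟨ ∑-distrib-+ (λ w → indegree w + # (w ⟶?_)) (λ _ → 1) ⟩
      sum (λ w → indegree w + # (w ⟶?_)) + sum {N} (λ _ → 1)
        ≡⟨ cong₂ _+_ (∑-distrib-+ indegree (λ w → # (w ⟶?_))) (trans (sum-const N 1) (*-identityʳ N)) ⟩
      (sum indegree + sum (λ w → # (w ⟶?_))) + N
        ≡⟨ cong (λ z → sum indegree + z + N) (trans (#-swap _⟶?_) (sym (+-identityʳ _))) ⟩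
      2 * sum indegree + N ∎
      where
      open ≤-Reasoning
      all? : Decidable₁ {A = Fin N} (λ _ → ⊤)
      all? _ = yes tt
      cases : ∀ w v → ⊤ → (v ⟶ w ⊎ w ⟶ v) ⊎ v ≡ w
      cases w v _ with v F.≟ w
      ... | yes e = inj₂ e
      ... | no ne = inj₁ (total ne)
      #all : # all? ≡ N
      #all = trans (#-sum all?) (trans (sum-const N 1) (*-identityʳ N))
      all-but-one : ∀ w → N ≤ (indegree w + # (w ⟶?_)) + 1
      all-but-one w = begin
        N ≡⟨ sym #all ⟩
        # all? ≤⟨ #-⊎ (cases w) all? (λ v → (v ⟶? w) ⊎-dec (w ⟶? v)) (λ v → v F.≟ w) ⟩
        _ ≤⟨ +-mono-≤ (#-⊎ (λ _ h → h) (λ v → (v ⟶? w) ⊎-dec (w ⟶? v)) (_⟶? w) (w ⟶?_)) (#-≡ w) ⟩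
        (indegree w + # (w ⟶?_)) + 1 ∎

    -- `many-edges` times `2 * N` is compared with the sum of `pointwise` over all `w`. The left
    -- side is twice the cube of `N`; one copy cancels against the term `N * (N * N)`, and `N * N`
    -- is divided out. The constant 1600 is 320 · 5.
    many-lexical : 1 ≤ N → N ≤ 4 * # lexical? + (1600 * (s * t) + 2)
    many-lexical 1≤N = +-cancelˡ-≤ N N _ (*-cancelˡ-≤ (N * N) ⦃ m*n≢0 N N ⦃ >-nonZero 1≤N ⦄ ⦃ >-nonZero 1≤N ⦄ ⦄ (begin
      N * N * (N + N) ≡⟨ lem₁ N ⟩
      2 * N * (N * N) ≤⟨ *-monoʳ-≤ (2 * N) many-edges ⟩
      2 * N * (2 * sum indegree + N) ≡⟨ lem₂ N (sum indegree) ⟩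
      4 * N * sum indegree + 2 * (N * N) ≤⟨ +-monoˡ-≤ (2 * (N * N)) summed ⟩
      (4 * N * N * # lexical? + (N * (N * N) + 320 * (N * (N * (5 * (s * t)))))) + 2 * (N * N)
        ≡⟨ lem₃ N (# lexical?) (s * t) ⟩
      N * N * (N + (4 * # lexical? + (1600 * (s * t) + 2))) ∎))
      where
      open ≤-Reasoning
      lem₁ : ∀ n → n * n * (n + n) ≡ 2 * n * (n * n)
      lem₁ = solve-∀
      lem₂ : ∀ n i → 2 * n * (2 * i + n) ≡ 4 * n * i + 2 * (n * n)
      lem₂ = solve-∀
      lem₃ : ∀ n w x → (4 * n * n * w + (n * (n * n) + 320 * (n * (n * (5 * x))))) + 2 * (n * n)
                     ≡ n * n * (n + (4 * w + (1600 * x + 2)))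
      lem₃ = solve-∀
      summed : 4 * N * sum indegree ≤ 4 * N * N * # lexical? + (N * (N * N) + 320 * (N * (N * (5 * (s * t)))))
      summed = begin
        4 * N * sum indegree ≡⟨ *-distribˡ-sum (4 * N) indegree ⟩
        sum (λ w → 4 * N * indegree w) ≤⟨ sum-mono pointwise ⟩
        sum (λ w → 4 * N * N * 𝟙 (lexical? w) + (N * N + 320 * Δ w))
          ≡⟨ ∑-distrib-+ (λ w → 4 * N * N * 𝟙 (lexical? w)) (λ w → N * N + 320 * Δ w) ⟩
        sum (λ w → 4 * N * N * 𝟙 (lexical? w)) + sum (λ w → N * N + 320 * Δ w)
         
            ≡⟨ cong₂ _+_ (trans (sym (*-distribˡ-sum (4 * N * N) (λ w → 𝟙 (lexical? w)))) (cong (4 * N * N *_) (sym (#-sum lexical?))))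
               (trans (∑-distrib-+ (λ _ → N * N) (λ w → 320 * Δ w)) (cong₂ _+_ (sum-const N _) (sym (*-distribˡ-sum 320 Δ)))) ⟩
        4 * N * N * # lexical? + (N * (N * N) + 320 * sum Δ)
          ≤⟨ +-monoʳ-≤ (4 * N * N * # lexical?) (+-monoʳ-≤ (N * (N * N)) (*-monoʳ-≤ 320 few-cherries)) ⟩
        4 * N * N * # lexical? + (N * (N * N) + 320 * (N * (N * (5 * (s * t))))) ∎

    -- Each lexical vertex of colour `γ` receives at least `N / 5` edges of colour `γ`, and by the
    -- outdegree bound there are at most `N * s` such edges.
    small-classes : 1 ≤ N → ∀ γ → # (λ w → lexical? w ×-dec (colour w F.≟ γ)) ≤ 5 * s
    small-classes 1≤N γ = *-cancelˡ-≤ N ⦃ >-nonZero 1≤N ⦄ (begin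
      N * # class? ≡⟨ cong (N *_) (#-sum class?) ⟩
      N * sum (λ w → 𝟙 (class? w)) ≡⟨ *-distribˡ-sum N (λ w → 𝟙 (class? w)) ⟩
      sum (λ w → N * 𝟙 (class? w)) ≤⟨ sum-mono each ⟩
      sum (λ w → 5 * # (λ v → (v ⟶? w) ×-dec (f v w F.≟ γ))) ≡⟨ sym (*-distribˡ-sum 5 (λ w → # (λ v → (v ⟶? w) ×-dec (f v w F.≟ γ)))) ⟩
      5 * sum (λ w → # (λ v → (v ⟶? w) ×-dec (f v w F.≟ γ))) ≡⟨ cong (5 *_) (sym (#-swap (λ v w → (v ⟶? w) ×-dec (f v w F.≟ γ)))) ⟩
      5 * sum (λ v → # (λ w → (v ⟶? w) ×-dec (f v w F.≟ γ))) ≤⟨ *-monoʳ-≤ 5 (sum-≤-const λ v → outdegree v γ) ⟩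
      5 * (N * s) ≡⟨ arith N s ⟩
      N * (5 * s) ∎)
      where
      open ≤-Reasoning
      arith : ∀ n s → 5 * (n * s) ≡ n * (5 * s)
      arith = solve-∀
      class? : ∀ w → Dec (IsLexical lex? w × colour w ≡ γ)
      class? w = lexical? w ×-dec (colour w F.≟ γ)
      each : ∀ w → N * 𝟙 (class? w) ≤ 5 * # (λ v → (v ⟶? w) ×-dec (f v w F.≟ γ))
      each w = 𝟙-≤ (class? w) λ (lex , e) → ≤-trans lex
        (*-monoʳ-≤ 5 (#-mono (λ v (h , e′) → h , trans e′ e) (lex? w) (λ v → (v ⟶? w) ×-dec (f v w F.≟ γ))))

-- Lists up to permutation.

open module ↭-Solver {A : Set} = CommutativeMonoidSolver (++-commutativeMonoid {A = A}) using (solve; _⊜_; _⊕_)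

unique-↭ : ∀ {A : Set} {xs ys : List A} → xs ↭ ys → Unique xs → Unique ys
unique-↭ {A} p = Setoid.Unique-resp-↭ (setoid A) (↭⇒↭ₛ p)

unique-++ˡ : ∀ {A : Set} (xs : List A) {ys} → Unique (xs ++ ys) → Unique xs
unique-++ˡ []       _          = []
unique-++ˡ (x ∷ xs) (x∉ ∷ xs!) = All.++⁻ˡ xs x∉ ∷ unique-++ˡ xs xs!

unique-++ʳ : ∀ {A : Set} (xs : List A) {ys} → Unique (xs ++ ys) → Unique ys
unique-++ʳ []       ys!       = ys!
unique-++ʳ (x ∷ xs) (_ ∷ xs!) = unique-++ʳ xs xs!

concatMap-↭ : ∀ {A C : Set} (g : A → List C) {xs ys} → xs ↭ ys → concatMap g xs ↭ concatMap g ys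
concatMap-↭ g refl = refl
concatMap-↭ g (prep x p) = ++⁺ˡ (g x) (concatMap-↭ g p)
concatMap-↭ g (swap {xs = xs} {ys} x y p) = ↭-trans
  (solve 3 (λ a b c → a ⊕ (b ⊕ c) ⊜ b ⊕ (a ⊕ c)) refl (g x) (g y) (concatMap g xs))
  (++⁺ˡ (g y) (++⁺ˡ (g x) (concatMap-↭ g p)))
concatMap-↭ g (_↭_.trans p q) = ↭-trans (concatMap-↭ g p) (concatMap-↭ g q)

related-pair : ∀ {A : Set} {R : A → A → Set} → Decidable R → (xs : List A) →
               AllPairs (λ x y → ¬ R x y) xs ⊎ ∃ λ x → ∃ λ y → ∃ λ rest → xs ↭ x ∷ y ∷ rest × R x y
related-pair R? [] = inj₁ []
related-pair {R = R} R? (x ∷ xs) with related-pair R? xs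
... | inj₂ (y , z , rest , p , r) = inj₂ (y , z , x ∷ rest , ↭-trans (prep x p)
        (↭-trans (swap x y refl) (prep y (swap x z refl))) , r)
... | inj₁ unrelated with related-to xs
  where
  related-to : ∀ ys → All (λ y → ¬ R x y) ys ⊎ ∃ λ y → ∃ λ rest → ys ↭ y ∷ rest × R x y
  related-to [] = inj₁ []
  related-to (y ∷ ys) with R? x y | related-to ys
  ... | yes r | _ = inj₂ (y , ys , refl , r)
  ... | no ¬r | inj₁ none = inj₁ (¬r ∷ none)
  ... | no ¬r | inj₂ (z , rest , p , r) = inj₂ (z , y ∷ rest , ↭-trans (prep y p) (swap y z refl) , r)
... | inj₁ none = inj₁ (none ∷ unrelated)
... | inj₂ (y , rest , p , r) = inj₂ (x , y , rest , prep x p , r)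

-- Merging paths with lexical ends.

module _ {V C : Set} {ℓ : V → V → C} (ℓ-sym : ∀ u v → ℓ u v ≡ ℓ v u) where

  -- The first path is run backwards from `b` to `a`, then the edge to `x` leads into the second.
  -- Vertices and labels are tracked only up to permutation, which is enough for uniqueness.
  join-reversed : ∀ {a b vs cs x y vs′ cs′} → Path ℓ a b vs cs → Path ℓ x y vs′ cs′ →
                  ∃ λ us → ∃ λ ds → Path ℓ b y us ds × us ↭ vs ++ vs′ × ds ↭ ℓ a x ∷ cs ++ cs′
  join-reversed [ a ] q = _ , _ , a ∷ q , refl , refl
  join-reversed {x = x} {vs′ = vs′} {cs′} (_∷_ a {a′} {vs = vs} {cs} p) q with join-reversed p (a ∷ q)
  ... | us , ds , r , us↭ , ds↭ = us , ds , r , ↭-trans us↭ (shift a vs vs′) ,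
    ↭-trans ds↭ (subst (λ z → z ∷ cs ++ ℓ a x ∷ cs′ ↭ ℓ a x ∷ ℓ a a′ ∷ cs ++ cs′) (ℓ-sym a a′)
      (↭-trans (prep _ (shift (ℓ a x) cs cs′)) (swap _ _ refl)))

module Merge {N B : ℕ} {f : Fin N → Fin N → Fin B} (f-sym : ∀ u v → f u v ≡ f v u)
  {colour : Fin N → Fin B}
  {Lex : Fin N → Fin N → Set} (lex? : Decidable Lex) (lex-colour : ∀ {w v} → Lex w v → f v w ≡ colour w)
  (β : ℕ) (β-small : 75 * β < N) where

  -- A path with lexical ends can be continued beyond its ends by edges of the colours of the ends;
  -- these two colours are therefore reserved for it.
  record Bundle : Set where
    constructor bundle
    field
      {from to}    : Fin N
      {vertices}   : List (Fin N)
      {labels}     : List (Fin B)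
      path         : Path f from to vertices labels
      from-lexical : IsLexical lex? from
      to-lexical   : IsLexical lex? to
    reserved : List (Fin B)
    reserved = colour from ∷ colour to ∷ labels

  open Bundle

  allVertices : List Bundle → List (Fin N)
  allVertices = concatMap vertices

  allReserved : List Bundle → List (Fin B)
  allReserved = concatMap reserved

  Close : Bundle → Bundle → Set
  Close P P′ = β < # (λ v → lex? (from P) v ×-dec lex? (from P′) v)

  close? : Decidable Close
  close? P P′ = _ <? _

  meets? : (Ps : List Bundle) (v : Fin N) → Dec (Any (λ P → Lex (from P) v) Ps)
  meets? Ps v = Any.any? (λ P → lex? (from P) v) Ps

  -- The binomial coefficient `k` over 2.
  pairs : ℕ → ℕ
  pairs zero    = 0
  pairs (suc k) = k + pairs k

  common-bound : ∀ P Ps → All (λ P′ → ¬ Close P P′) Ps →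
            # (λ v → lex? (from P) v ×-dec meets? Ps v) ≤ β * length Ps
  common-bound P [] [] = ≤-reflexive (trans (#-empty (λ v → lex? (from P) v ×-dec meets? [] v) λ { _ (_ , ()) }) (sym (*-zeroʳ β)))
  common-bound P (P′ ∷ Ps) (¬close ∷ ¬closes) = begin
    # (λ v → lex? (from P) v ×-dec meets? (P′ ∷ Ps) v)
      ≤⟨ #-⊎ (λ { _ (h , here h′) → inj₁ (h , h′) ; _ (h , there h′) → inj₂ (h , h′) })
           (λ v → lex? (from P) v ×-dec meets? (P′ ∷ Ps) v)
           (λ v → lex? (from P) v ×-dec lex? (from P′) v) (λ v → lex? (from P) v ×-dec meets? Ps v) ⟩
    # (λ v → lex? (from P) v ×-dec lex? (from P′) v) + # (λ v → lex? (from P) v ×-dec meets? Ps v)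
      ≤⟨ +-mono-≤ (≮⇒≥ ¬close) (common-bound P Ps ¬closes) ⟩
    β + β * length Ps ≡⟨ sym (*-suc β (length Ps)) ⟩
    β * suc (length Ps) ∎
    where open ≤-Reasoning

  -- The Bonferroni inequality for sets of size at least `N / 5` with pairwise intersections of size
  -- at most `β`, multiplied by 5.
  bonferroni : ∀ Ps → AllPairs (λ P P′ → ¬ Close P P′) Ps →
               length Ps * N ≤ 5 * # (meets? Ps) + 5 * (β * pairs (length Ps))
  bonferroni [] [] = z≤n
  bonferroni (P ∷ Ps) (¬close ∷ ¬closes) = begin
    N + length Ps * N ≤⟨ +-mono-≤ (from-lexical P) (bonferroni Ps ¬closes) ⟩
    5 * # (lex? (from P)) + (5 * # (meets? Ps) + 5 * (β * pairs k))
      ≡⟨ arith₁ (# (lex? (from P))) (# (meets? Ps)) (β * pairs k) ⟩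
    5 * (# (lex? (from P)) + # (meets? Ps)) + 5 * (β * pairs k)
      ≤⟨ +-monoˡ-≤ (5 * (β * pairs k)) (*-monoʳ-≤ 5 (≤-trans (#-∪∩ (lex? (from P)) (meets? Ps))
           (+-mono-≤ (#-mono (λ { _ (inj₁ h) → here h ; _ (inj₂ h) → there h })
                       (λ v → lex? (from P) v ⊎-dec meets? Ps v) (meets? (P ∷ Ps)))
                     (common-bound P Ps ¬close)))) ⟩
    5 * (# (meets? (P ∷ Ps)) + β * k) + 5 * (β * pairs k) ≡⟨ arith₂ (# (meets? (P ∷ Ps))) β k (pairs k) ⟩
    5 * # (meets? (P ∷ Ps)) + 5 * (β * (k + pairs k)) ∎
    where
    open ≤-Reasoning
    k = length Ps
    arith₁ : ∀ a b c → 5 * a + (5 * b + 5 * c) ≡ 5 * (a + b) + 5 * c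
    arith₁ = solve-∀
    arith₂ : ∀ a b k c → 5 * (a + b * k) + 5 * (b * c) ≡ 5 * a + 5 * (b * (k + c))
    arith₂ = solve-∀

  -- Six pairwise far bundles have 15 pairs, so `6 * N ≤ 5 * N + 5 * (β * 15)`, against
  -- `75 * β < N`.
  at-most-five : ∀ Ps → AllPairs (λ P P′ → ¬ Close P P′) Ps → length Ps ≤ 5
  at-most-five Ps@(P₁ ∷ P₂ ∷ P₃ ∷ P₄ ∷ P₅ ∷ P₆ ∷ _) far = contradiction
    (+-cancelˡ-≤ (5 * N) N (75 * β) (begin
      5 * N + N ≡⟨ arith₁ N ⟩
      6 * N ≤⟨ bonferroni (take 6 Ps) (AllPairs.take⁺ 6 far) ⟩
      5 * # (meets? (take 6 Ps)) + 5 * (β * 15)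
        ≤⟨ +-monoˡ-≤ (5 * (β * 15)) (*-monoʳ-≤ 5 (#≤n (meets? (take 6 Ps)))) ⟩
      5 * N + 5 * (β * 15) ≡⟨ cong (5 * N +_) (arith₂ β) ⟩
      5 * N + 75 * β ∎))
    (<⇒≱ β-small)
    where
    open ≤-Reasoning
    arith₁ : ∀ n → 5 * n + n ≡ 6 * n
    arith₁ = solve-∀
    arith₂ : ∀ b → 5 * (b * 15) ≡ 75 * b
    arith₂ = solve-∀
  at-most-five [] _ = z≤n
  at-most-five (_ ∷ []) _ = s≤s z≤n
  at-most-five (_ ∷ _ ∷ []) _ = s≤s (s≤s z≤n)
  at-most-five (_ ∷ _ ∷ _ ∷ []) _ = s≤s (s≤s (s≤s z≤n))
  at-most-five (_ ∷ _ ∷ _ ∷ _ ∷ []) _ = s≤s (s≤s (s≤s (s≤s z≤n)))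
  at-most-five (_ ∷ _ ∷ _ ∷ _ ∷ _ ∷ []) _ = s≤s (s≤s (s≤s (s≤s (s≤s z≤n))))

  -- A merge uses one new vertex and lowers the number of bundles by one, so the sum in `bounded` is
  -- invariant under merging.
  record Family (Ps : List Bundle) : Set where
    field
      vertices! : Unique (allVertices Ps)
      reserved! : Unique (allReserved Ps)
      bounded   : length (allVertices Ps) + length Ps ≤ β

  -- The two edges at the connecting vertex `z` have the colours of the two joined ends. These were
  -- reserved and now become labels, while the colours of the other two ends stay reserved; the
  -- reserved colours are the same up to order.
  merge : ∀ {P P′ rest} → Close P P′ → Family (P ∷ P′ ∷ rest) →
          ∃ λ Q → Family (Q ∷ rest) × length (allVertices (P ∷ P′ ∷ rest)) ≤ length (allVertices (Q ∷ rest))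
  merge {P} {P′} {rest} close fam
    with pick (λ v → lex? (from P) v ×-dec lex? (from P′) v) (_∈? allVertices (P ∷ P′ ∷ rest))
           (≤-<-trans (≤-trans (#-∈ (allVertices (P ∷ P′ ∷ rest))) (≤-trans (m≤m+n _ _) (Family.bounded fam))) close)
  ... | z , (za , za′) , z∉ with join-reversed f-sym (path P) (z ∷ path P′)
  ... | us , ds , r , us↭ , ds↭ = Q , record
      { vertices! = unique-↭ (↭-sym vertices↭) (∉⇒All z∉ ∷ vertices!)
      ; reserved! = unique-↭ (↭-sym reserved↭) reserved!
      ; bounded   = ≤-trans (≤-reflexive (trans (cong (_+ suc (length rest)) (↭-length vertices↭))
                      (sym (+-suc _ (suc (length rest)))))) bounded }
    , ≤-trans (n≤1+n _) (≤-reflexive (sym (↭-length vertices↭)))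
    where
    open Family fam
    Q : Bundle
    Q = bundle r (to-lexical P) (to-lexical P′)
    vertices↭ : allVertices (Q ∷ rest) ↭ z ∷ allVertices (P ∷ P′ ∷ rest)
    vertices↭ = ↭-trans (++⁺ʳ (allVertices rest) us↭)
      (solve 4 (λ a x b c → (a ⊕ (x ⊕ b)) ⊕ c ⊜ x ⊕ (a ⊕ (b ⊕ c))) refl
        (vertices P) (z ∷ []) (vertices P′) (allVertices rest))
    new-labels : ds ↭ colour (from P) ∷ labels P ++ colour (from P′) ∷ labels P′
    new-labels = subst₂ (λ x y → ds ↭ x ∷ labels P ++ y ∷ labels P′)
      (trans (f-sym (from P) z) (lex-colour za)) (lex-colour za′) ds↭
    reserved↭ : allReserved (Q ∷ rest) ↭ allReserved (P ∷ P′ ∷ rest)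
    reserved↭ = ↭-trans (++⁺ʳ (allReserved rest) (prep _ (prep _ new-labels)))
      (solve 7
        (λ b b′ a l a′ l′ c → (b ⊕ (b′ ⊕ (a ⊕ (l ⊕ (a′ ⊕ l′))))) ⊕ c ⊜ (a ⊕ (b ⊕ l)) ⊕ ((a′ ⊕ (b′ ⊕ l′)) ⊕ c)) refl
        (colour (to P) ∷ []) (colour (to P′) ∷ []) (colour (from P) ∷ []) (labels P)
        (colour (from P′) ∷ []) (labels P′) (allReserved rest))

  family-↭ : ∀ {Ps Qs} → Ps ↭ Qs → Family Ps → Family Qs
  family-↭ p fam = record
    { vertices! = unique-↭ (concatMap-↭ vertices p) vertices!
    ; reserved! = unique-↭ (concatMap-↭ reserved p) reserved!
    ; bounded   = ≤-trans (≤-reflexive (sym (cong₂ _+_ (↭-length (concatMap-↭ vertices p)) (↭-length p)))) bounded }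
    where open Family fam

  mergeAll : ∀ fuel {Ps} → length Ps ≤ fuel → Family Ps →
             ∃ λ Qs → Family Qs × length Qs ≤ 5 × length (allVertices Ps) ≤ length (allVertices Qs)
  mergeAll fuel {Ps} le fam with related-pair close? Ps
  ... | inj₁ far = Ps , fam , at-most-five Ps far , ≤-refl
  ... | inj₂ (P , P′ , rest , p , close) with merge close (family-↭ p fam)
  ... | Q , fam′ , grows = continue fuel le
    where
    continue : ∀ fuel → length Ps ≤ fuel →
               ∃ λ Qs → Family Qs × length Qs ≤ 5 × length (allVertices Ps) ≤ length (allVertices Qs)
    continue zero le = contradiction (≤-trans (≤-reflexive (sym (↭-length p))) le) λ ()
    continue (suc fuel) le with mergeAll fuel {Q ∷ rest} (≤-pred (≤-trans (≤-reflexive (sym (↭-length p))) le)) fam′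
    ... | Qs , famQ , few , grows′ = Qs , famQ , few ,
      ≤-trans (≤-reflexive (↭-length (concatMap-↭ vertices p))) (≤-trans grows grows′)

  long-member : ∀ {t} k Ps → length Ps ≤ k → Unique (allVertices Ps) → Unique (allReserved Ps) →
                k * t < length (allVertices Ps) → RainbowPath f (suc t)
  long-member zero    (P ∷ Ps) () _ _ _
  long-member {t} (suc k) (P ∷ Ps) (s≤s le) vs! cs! big with suc t ≤? length (vertices P)
  ... | yes long with unique-++ˡ (reserved P) cs!
  ... | _ ∷ _ ∷ labels! = rainbow (path P) (unique-++ˡ (vertices P) vs!) labels! long
  long-member {t} (suc k) (P ∷ Ps) (s≤s le) vs! cs! big | no short =
    long-member k Ps le (unique-++ʳ (vertices P) vs!) (unique-++ʳ (reserved P) cs!)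
      (+-cancelˡ-< t _ _ (<-≤-trans big (≤-trans (≤-reflexive (length-++ (vertices P)))
        (+-monoˡ-≤ _ (≤-pred (≰⇒> short))))))

  -- Once no pair is close, at most five paths share at least `5 * t` vertices, so one of them has
  -- at least `t`.
  family⇒rainbow : ∀ {t Ps} → 1 ≤ t → Family Ps → 5 * t ≤ length (allVertices Ps) → RainbowPath f t
  family⇒rainbow {suc t} _ fam big with mergeAll _ ≤-refl fam
  ... | Qs , famQ , few , grows = long-member 5 Qs few (Family.vertices! famQ) (Family.reserved! famQ)
    (<-≤-trans (*-monoʳ-< 5 (n<1+n t)) (≤-trans big grows))

-- Averaging over bipartitions of the colours.

-- The sum over the Boolean cube, in place of an expectation over a random bipartition.
∑σ : ∀ n → (Vec Bool n → ℕ) → ℕ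
∑σ zero    g = g []
∑σ (suc n) g = ∑σ n (g ∘ (true ∷_)) + ∑σ n (g ∘ (false ∷_))

∑σ-mono : ∀ n {g h : Vec Bool n → ℕ} → (∀ σ → g σ ≤ h σ) → ∑σ n g ≤ ∑σ n h
∑σ-mono zero    le = le []
∑σ-mono (suc n) le = +-mono-≤ (∑σ-mono n (le ∘ (true ∷_))) (∑σ-mono n (le ∘ (false ∷_)))

∑σ-cong : ∀ n {g h : Vec Bool n → ℕ} → (∀ σ → g σ ≡ h σ) → ∑σ n g ≡ ∑σ n h
∑σ-cong zero    eq = eq []
∑σ-cong (suc n) eq = cong₂ _+_ (∑σ-cong n (eq ∘ (true ∷_))) (∑σ-cong n (eq ∘ (false ∷_)))

∑σ-const : ∀ n k → ∑σ n (λ _ → k) ≡ 2 ^ n * k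
∑σ-const zero    k = sym (+-identityʳ k)
∑σ-const (suc n) k rewrite ∑σ-const n k = lem (2 ^ n) k
  where
  lem : ∀ a k → a * k + a * k ≡ 2 * a * k
  lem = solve-∀

∑σ-+ : ∀ n (g h : Vec Bool n → ℕ) → ∑σ n (λ σ → g σ + h σ) ≡ ∑σ n g + ∑σ n h
∑σ-+ zero    g h = refl
∑σ-+ (suc n) g h rewrite ∑σ-+ n (g ∘ (true ∷_)) (h ∘ (true ∷_)) | ∑σ-+ n (g ∘ (false ∷_)) (h ∘ (false ∷_)) =
  lem (∑σ n (g ∘ (true ∷_))) _ _ _
  where
  lem : ∀ a b c d → (a + b) + (c + d) ≡ (a + c) + (b + d)
  lem = solve-∀

∑σ-sum : ∀ n {m} (h : Fin m → Vec Bool n → ℕ) → sum (λ i → ∑σ n (h i)) ≡ ∑σ n (λ σ → sum λ i → h i σ)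
∑σ-sum zero    h = refl
∑σ-sum (suc n) h = trans (∑-distrib-+ (λ i → ∑σ n (h i ∘ (true ∷_))) (λ i → ∑σ n (h i ∘ (false ∷_))))
  (cong₂ _+_ (∑σ-sum n (λ i → h i ∘ (true ∷_))) (∑σ-sum n (λ i → h i ∘ (false ∷_))))

-- Translation by `μ` permutes the cube.
∑σ-xor : ∀ n (μ : Vec Bool n) (g : Vec Bool n → ℕ) → ∑σ n (g ∘ zipWith _xor_ μ) ≡ ∑σ n g
∑σ-xor zero    []          g = refl
∑σ-xor (suc n) (false ∷ μ) g = cong₂ _+_ (∑σ-xor n μ (g ∘ (true ∷_))) (∑σ-xor n μ (g ∘ (false ∷_)))
∑σ-xor (suc n) (true ∷ μ)  g = trans (cong₂ _+_ (∑σ-xor n μ (g ∘ (false ∷_))) (∑σ-xor n μ (g ∘ (true ∷_))))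
  (+-comm (∑σ n (g ∘ (false ∷_))) _)

∑σ-average : ∀ n {k} (g : Vec Bool n → ℕ) → 2 ^ n * k ≤ ∑σ n g → ∃ λ σ → k ≤ g σ
∑σ-average zero    {k} g le = [] , ≤-trans (≤-reflexive (sym (+-identityʳ k))) le
∑σ-average (suc n) {k} g le with 2 ^ n * k ≤? ∑σ n (g ∘ (true ∷_))
... | yes le′ = let σ , h = ∑σ-average n (g ∘ (true ∷_)) le′ in true ∷ σ , h
... | no ¬le = let σ , h = ∑σ-average n (g ∘ (false ∷_)) le″ in false ∷ σ , h
  where
  lem : ∀ a k → a * k + a * k ≡ 2 * a * k
  lem = solve-∀
  le″ : 2 ^ n * k ≤ ∑σ n (g ∘ (false ∷_))
  le″ = +-cancelˡ-≤ (2 ^ n * k) _ _ (≤-trans (≤-reflexive (lem (2 ^ n) k)) (≤-trans le (+-monoˡ-≤ _ (<⇒≤ (≰⇒> ¬le)))))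

-- A balanced bipartition of the colours: flipping every colour except that of v exchanges the targets of v
-- on the two sides, so v keeps half of its targets on the far side in one of the two bipartitions.
module Bipartition {N B : ℕ} (colour : Fin N → Fin B)
  {W : Fin N → Set} (W? : Decidable₁ W)
  {Target : Fin N → Fin N → Set} (target? : Decidable Target)
  (target-colour : ∀ {v u} → Target v u → colour v ≢ colour u) where

  far? : ∀ (σ : Vec Bool B) v u → Dec (Target v u × Vec.lookup σ (colour u) ≡ false)
  far? σ v u = target? v u ×-dec (Vec.lookup σ (colour u) Bool.≟ false)

  good? : ∀ (σ : Vec Bool B) v → Dec (W v × Vec.lookup σ (colour v) ≡ true × # (target? v) ≤ 2 * # (far? σ v))
  good? σ v = W? v ×-dec (Vec.lookup σ (colour v) Bool.≟ true) ×-dec (_ ≤? _)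

  private
    others : Fin B → Vec Bool B
    others γ = tabulate λ δ → not (does (γ F.≟ δ))

    flip-others : Fin B → Vec Bool B → Vec Bool B
    flip-others γ = zipWith _xor_ (others γ)

    flip-all : Vec Bool B → Vec Bool B
    flip-all = zipWith _xor_ (replicate B true)

    lookup-flip-own : ∀ γ σ → Vec.lookup (flip-others γ σ) γ ≡ Vec.lookup σ γ
    lookup-flip-own γ σ rewrite Vec.lookup-zipWith _xor_ γ (others γ) σ
      | Vec.lookup∘tabulate (λ δ → not (does (γ F.≟ δ))) γ with γ F.≟ γ
    ... | yes _ = refl
    ... | no γ≢ = contradiction refl γ≢

    lookup-flip-other : ∀ {γ δ} σ → γ ≢ δ → Vec.lookup (flip-others γ σ) δ ≡ not (Vec.lookup σ δ)
    lookup-flip-other {γ} {δ} σ γ≢δ rewrite Vec.lookup-zipWith _xor_ δ (others γ) σ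
      | Vec.lookup∘tabulate (λ δ → not (does (γ F.≟ δ))) δ with γ F.≟ δ
    ... | yes e = contradiction e γ≢δ
    ... | no _ = refl

    lookup-flip-all : ∀ γ σ → Vec.lookup (flip-all σ) γ ≡ not (Vec.lookup σ γ)
    lookup-flip-all γ σ rewrite Vec.lookup-zipWith _xor_ γ (replicate B true) σ | Vec.lookup-replicate γ true = refl

    -- A target never has the colour of `v`, so its side is changed by the flip and it is far in
    -- exactly one of the two bipartitions.
    split : ∀ σ v → # (target? v) ≤ # (far? σ v) + # (far? (flip-others (colour v) σ) v)
    split σ v = #-⊎ cases (target? v) (far? σ v) (far? (flip-others (colour v) σ) v)
      where
      cases : ∀ u → Target v u → (Target v u × Vec.lookup σ (colour u) ≡ false) ⊎
                                 (Target v u × Vec.lookup (flip-others (colour v) σ) (colour u) ≡ false)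
      cases u h with Vec.lookup σ (colour u) in eq
      ... | false = inj₁ (h , refl)
      ... | true  = inj₂ (h , trans (lookup-flip-other σ (target-colour h)) (cong not eq))

    half : ∀ {d a b} → d ≤ a + b → ¬ d ≤ 2 * a → d ≤ 2 * b
    half {d} {a} {b} le ¬le = +-cancelˡ-≤ d d (2 * b) (begin
      d + d ≡⟨ lem₁ d ⟩
      2 * d ≤⟨ *-monoʳ-≤ 2 le ⟩
      2 * (a + b) ≡⟨ *-distribˡ-+ 2 a b ⟩
      2 * a + 2 * b ≤⟨ +-monoˡ-≤ (2 * b) (<⇒≤ (≰⇒> ¬le)) ⟩
      d + 2 * b ∎)
      where
      open ≤-Reasoning
      lem₁ : ∀ d → d + d ≡ 2 * d
      lem₁ = solve-∀

    module _ (v : Fin N) (w : W v) where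
      h : Vec Bool B → ℕ
      h σ = 𝟙 (good? σ v)

      own-side : ∀ σ → Vec.lookup σ (colour v) ≡ true → 1 ≤ h σ + h (flip-others (colour v) σ)
      own-side σ e = cases (_ ≤? _)
        where
        cases : Dec (# (target? v) ≤ 2 * # (far? σ v)) → 1 ≤ h σ + h (flip-others (colour v) σ)
        cases (yes le) = ≤-trans (≤-reflexive (sym (𝟙-yes (good? σ v) (w , e , le)))) (m≤m+n (h σ) _)
        cases (no ¬le) = ≤-trans (≤-reflexive (sym (𝟙-yes (good? (flip-others (colour v) σ) v)
          (w , trans (lookup-flip-own (colour v) σ) e , half {# (target? v)} {# (far? σ v)} (split σ v) ¬le)))) (m≤n+m _ (h σ))

      H : Vec Bool B → ℕ
      H σ = h σ + h (flip-others (colour v) σ)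

      -- `σ` or its complement puts `v` on the near side, and that bipartition or its flip outside
      -- the colour of `v` leaves half of the targets far.
      one-of-four : ∀ σ → 1 ≤ H σ + H (flip-all σ)
      one-of-four σ = cases (Vec.lookup σ (colour v) Bool.≟ true)
        where
        cases : Dec (Vec.lookup σ (colour v) ≡ true) → 1 ≤ H σ + H (flip-all σ)
        cases (yes e) = ≤-trans (own-side σ e) (m≤m+n (H σ) _)
        cases (no ¬e) = ≤-trans (own-side (flip-all σ) (trans (lookup-flip-all (colour v) σ)
          (cong not (Bool.¬-not ¬e)))) (m≤n+m _ (H σ))

      -- The four bipartitions in `one-of-four` are translates of `σ`, so each contributes the same
      -- sum over the cube.
      quarter : 2 ^ B * 1 ≤ 4 * ∑σ B h
      quarter = begin
        2 ^ B * 1 ≡⟨ sym (∑σ-const B 1) ⟩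
        ∑σ B (λ _ → 1) ≤⟨ ∑σ-mono B one-of-four ⟩
        ∑σ B (λ σ → H σ + H (flip-all σ)) ≡⟨ ∑σ-+ B H (H ∘ flip-all) ⟩
        ∑σ B H + ∑σ B (H ∘ flip-all) ≡⟨ cong (∑σ B H +_) (∑σ-xor B (replicate B true) H) ⟩
        ∑σ B H + ∑σ B H ≡⟨ cong (λ z → z + z) (trans (∑σ-+ B h (h ∘ flip-others (colour v)))
                              (cong (∑σ B h +_) (∑σ-xor B (others (colour v)) h))) ⟩
        (∑σ B h + ∑σ B h) + (∑σ B h + ∑σ B h) ≡⟨ lem (∑σ B h) ⟩
        4 * ∑σ B h ∎
        where
        open ≤-Reasoning
        lem : ∀ x → (x + x) + (x + x) ≡ 4 * x
        lem = solve-∀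

  -- Pairs of a vertex and a bipartition for which it is good are counted in both ways; `quarter`
  -- bounds the contribution of each vertex from below.
  balanced : ∃ λ σ → # W? ≤ 4 * # (good? σ)
  balanced = ∑σ-average B (λ σ → 4 * # (good? σ)) (begin
    2 ^ B * # W? ≡⟨ cong (2 ^ B *_) (#-sum W?) ⟩
    2 ^ B * sum (λ v → 𝟙 (W? v)) ≡⟨ *-distribˡ-sum (2 ^ B) (λ v → 𝟙 (W? v)) ⟩
    sum (λ v → 2 ^ B * 𝟙 (W? v)) ≤⟨ sum-mono (λ v → 𝟙-≤ (W? v) λ w → ≤-trans (≤-reflexive (sym (*-identityʳ (2 ^ B)))) (quarter v w)) ⟩
    sum (λ v → 4 * ∑σ B (λ σ → 𝟙 (good? σ v))) ≡⟨ sym (*-distribˡ-sum 4 (λ v → ∑σ B (λ σ → 𝟙 (good? σ v)))) ⟩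
    4 * sum (λ v → ∑σ B (λ σ → 𝟙 (good? σ v))) ≡⟨ cong (4 *_) (∑σ-sum B (λ v σ → 𝟙 (good? σ v))) ⟩
    4 * ∑σ B (λ σ → sum λ v → 𝟙 (good? σ v)) ≡⟨ lem (∑σ B (λ σ → sum λ v → 𝟙 (good? σ v))) ⟩
    (S + S) + (S + S)
      ≡⟨ sym (trans (∑σ-+ B (λ σ → K σ + K σ) (λ σ → K σ + K σ)) (cong (λ z → z + z) (∑σ-+ B K K))) ⟩
    ∑σ B (λ σ → (K σ + K σ) + (K σ + K σ)) ≡⟨ ∑σ-cong B (λ σ → trans (sym (lem (K σ))) (cong (4 *_) (sym (#-sum (good? σ))))) ⟩
    ∑σ B (λ σ → 4 * # (good? σ)) ∎)
    where
    open ≤-Reasoning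
    K : Vec Bool B → ℕ
    K σ = sum λ v → 𝟙 (good? σ v)
    S = ∑σ B K
    lem : ∀ x → 4 * x ≡ (x + x) + (x + x)
    lem = solve-∀

-- Greedy independent sets, and Hamiltonian paths in semicomplete digraphs.

module _ {N : ℕ} {R : Fin N → Fin N → Set} (R? : Decidable R) (R-refl : ∀ v → R v v) (q : ℕ) where

  -- A vertex with at most `q` related vertices is chosen and these are discarded; the hypothesis
  -- applies again to what remains. Reflexivity counts the chosen vertex among the discarded ones.
  independent : {Y : Fin N → Set} (Y? : Decidable₁ Y) →
    (∀ {Z : Fin N → Set} (Z? : Decidable₁ Z) → (∀ {v} → Z v → Y v) → ∃ Z →
      ∃ λ v → Z v × # (λ u → Z? u ×-dec R? v u) ≤ q) →
    ∃ λ I → All Y I × AllPairs (λ v u → ¬ R v u) I × # Y? ≤ q * length I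
  independent {Y} Y? sparse = choose N Y? (λ y → y) (#≤n Y?)
    where
    choose : ∀ fuel {Z} (Z? : Decidable₁ Z) → (∀ {v} → Z v → Y v) → # Z? ≤ fuel →
             ∃ λ I → All Z I × AllPairs (λ v u → ¬ R v u) I × # Z? ≤ q * length I
    choose fuel {Z} Z? Z⊆Y le with F.any? Z?
    ... | no none = [] , [] , [] , ≤-trans (≤-reflexive (#-empty Z? λ i z → none (i , z))) z≤n
    ... | yes point with sparse Z? Z⊆Y point
    ... | v , zv , few = continue fuel le
      where
      Z′? : Decidable₁ (λ u → Z u × ¬ R v u)
      Z′? u = Z? u ×-dec ¬? (R? v u)
      fewer : # Z′? < # Z?
      fewer = #-strict (λ _ → proj₁) Z′? Z? v (λ (_ , ¬r) → ¬r (R-refl v)) zv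
      continue : ∀ fuel → # Z? ≤ fuel → ∃ λ I → All Z I × AllPairs (λ v u → ¬ R v u) I × # Z? ≤ q * length I
      continue zero le = contradiction (≤-trans fewer le) λ ()
      continue (suc fuel) le with choose fuel Z′? (Z⊆Y ∘ proj₁) (≤-pred (≤-trans fewer le))
      ... | I , I⊆ , ind , count = v ∷ I , zv ∷ All.map proj₁ I⊆ , All.map proj₂ I⊆ ∷ ind , (begin
        # Z? ≤⟨ #-⊎ cases Z? (λ u → Z? u ×-dec R? v u) Z′? ⟩
        # (λ u → Z? u ×-dec R? v u) + # Z′? ≤⟨ +-mono-≤ few count ⟩
        q + q * length I ≡⟨ sym (*-suc q (length I)) ⟩
        q * suc (length I) ∎)
        where
        open ≤-Reasoning
        cases : ∀ u → Z u → (Z u × R v u) ⊎ (Z u × ¬ R v u)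
        cases u z with R? v u
        ... | yes r = inj₁ (z , r)
        ... | no ¬r = inj₂ (z , ¬r)

module _ {A : Set} {E : A → A → Set} (E? : Decidable E) where

  -- `x` moves along the path until it has an edge to the next vertex; each vertex it passes has an
  -- edge to it.
  insert-after : ∀ x y ys → Linked E (y ∷ ys) → E y x → All (λ z → E x z ⊎ E z x) ys →
                 ∃ λ zs → Linked E (y ∷ zs) × zs ↭ x ∷ ys
  insert-after x y [] _ yx [] = x ∷ [] , yx ∷ [-] , refl
  insert-after x y (z ∷ zs) (yz ∷ l) yx (xz ∷ rest) with E? x z
  ... | yes e = x ∷ z ∷ zs , yx ∷ e ∷ l , refl
  ... | no ¬e with insert-after x z zs l ([ (λ e → contradiction e ¬e) , (λ e → e) ]′ xz) rest
  ... | zs′ , l′ , p = z ∷ zs′ , yz ∷ l′ , ↭-trans (prep z p) (swap z x refl)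

  -- Rédei's theorem, for semicomplete digraphs.
  hamiltonian : ∀ x xs → AllPairs (λ y z → E y z ⊎ E z y) (x ∷ xs) →
                ∃ λ y → ∃ λ ys → Linked E (y ∷ ys) × y ∷ ys ↭ x ∷ xs
  hamiltonian x [] _ = x , [] , [-] , refl
  hamiltonian x (x′ ∷ xs) (xs~ ∷ pairs) with hamiltonian x′ xs pairs
  ... | y , ys , l , p with E? x y | All-resp-↭ (↭-sym p) xs~
  ... | yes e | _ = x , y ∷ ys , e ∷ l , prep x p
  ... | no ¬e | xy ∷ rest with insert-after x y ys l ([ (λ e → contradiction e ¬e) , (λ e → e) ]′ xy) rest
  ... | zs , l′ , p′ = y , zs , l′ , ↭-trans (prep y p′) (↭-trans (swap y x refl) (prep x p))

module _ {V C : Set} {ℓ : V → V → C} {colour : V → C} where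

  -- Each edge carries the colour of its first vertex, so only the colour of the last vertex is
  -- missing among the labels.
  linked⇒path : ∀ {x xs} → Linked (λ y z → ℓ y z ≡ colour y) (x ∷ xs) →
                ∃ λ y → ∃ λ cs → Path ℓ x y (x ∷ xs) cs × colour y ∷ cs ↭ map colour (x ∷ xs)
  linked⇒path {x} [-] = x , [] , [ x ] , refl
  linked⇒path {x} (e ∷ l) with linked⇒path l
  ... | y , cs , p , perm = y , _ , x ∷ p ,
    subst (λ z → colour y ∷ z ∷ cs ↭ colour x ∷ _) (sym e) (↭-trans (swap (colour y) (colour x) refl) (prep (colour x) perm))

-- Foreign edges and chains.

module _ {N B : ℕ} (f : Fin N → Fin N → Fin B) (colour : Fin N → Fin B) where

  Foreign : Fin N → Fin N → Set
  Foreign v u = colour v ≢ colour u × f v u ≢ colour v × f v u ≢ colour u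

  foreign? : Decidable Foreign
  foreign? v u = ¬? (colour v F.≟ colour u) ×-dec ¬? (f v u F.≟ colour v) ×-dec ¬? (f v u F.≟ colour u)

module Levels {N B s t : ℕ} (1≤s : 1 ≤ s) (1≤t : 1 ≤ t)
  {f : Fin N → Fin N → Fin B} (f-sym : ∀ u v → f u v ≡ f v u)
  {_⟶_ : Fin N → Fin N → Set} (_⟶?_ : Decidable _⟶_)
  (total : ∀ {u v} → u ≢ v → u ⟶ v ⊎ v ⟶ u)
  (outdegree : ∀ v γ → # (λ w → (v ⟶? w) ×-dec (f v w F.≟ γ)) ≤ s)
  {colour : Fin N → Fin B}
  {Lex : Fin N → Fin N → Set} (lex? : Decidable Lex) (lex-colour : ∀ {w v} → Lex w v → f v w ≡ colour w)
  (N-large : 75 * (30 * t) < N)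
  {Clean : Fin N → Set} (clean? : Decidable₁ Clean)
  (clean-lexical : ∀ {v} → Clean v → IsLexical lex? v)
  (small-classes : ∀ γ → # (λ w → clean? w ×-dec (colour w F.≟ γ)) ≤ 5 * s)
  (foreign-label : ∀ {v u w} → Clean v → Clean u → Foreign f colour v u → Clean w → f v u ≢ colour w)
  where

  open Merge f-sym lex? lex-colour (30 * t) N-large

  -- The candidates for a turn at the vertex `v`. The orientation is included so that `outdegree`
  -- limits how many of them a used label excludes.
  Target : Fin N → Fin N → Set
  Target v u = Clean u × v ⟶ u × Foreign f colour v u

  target? : Decidable Target
  target? v u = clean? u ×-dec (v ⟶? u) ×-dec foreign? f colour v u

  -- The pairs excluded from a common chain. Any other edge has the colour of one of its ends and
  -- can be directed away from it.
  Conflict : Fin N → Fin N → Set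
  Conflict v u = colour v ≡ colour u ⊎ Foreign f colour v u

  conflict? : Decidable Conflict
  conflict? v u = (colour v F.≟ colour u) ⊎-dec foreign? f colour v u

  foreign-sym : ∀ {v u} → Foreign f colour v u → Foreign f colour u v
  foreign-sym {v} {u} (c≢ , ≢v , ≢u) = c≢ ∘ sym , ≢u ∘ trans (f-sym v u) , ≢v ∘ trans (f-sym v u)

  -- The number of conflicts is averaged over `Z`. A colour class accounts for at most `5 * s`; a
  -- foreign edge makes one of its ends a target of the other, so such edges account for at most
  -- `2 * e` on average.
  sparse : ∀ e {Z : Fin N → Set} (Z? : Decidable₁ Z) → (∀ {v} → Z v → Clean v) →
           (∀ {v} → Z v → # (target? v) ≤ e) → ∃ Z →
           ∃ λ v → Z v × # (λ u → Z? u ×-dec conflict? v u) ≤ 2 * e + 5 * s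
  sparse e {Z} Z? Z⊆ d≤e point with average Z? (λ v → # (λ u → Z? u ×-dec conflict? v u)) point
  ... | v , zv , le = v , zv , *-cancelˡ-≤ (# Z?) ⦃ >-nonZero (#-pos Z? (proj₁ point) (proj₂ point)) ⦄ (begin
    # Z? * # (λ u → Z? u ×-dec conflict? v u) ≤⟨ le ⟩
    sum (λ v → 𝟙 (Z? v) * # (λ u → Z? u ×-dec conflict? v u))
      ≡⟨ sum-cong-≋ (λ v → sym (#-guard-≡ (Z? v) (λ u → Z? u ×-dec conflict? v u))) ⟩
    sum (λ v → # (λ u → Z? v ×-dec Z? u ×-dec conflict? v u))
      ≤⟨ sum-mono (λ v → ≤-trans (#-⊎ (cases v) (λ u → Z? v ×-dec Z? u ×-dec conflict? v u) (same? v) (arc? v))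
           (+-monoʳ-≤ (# (same? v)) (#-⊎ (λ _ h → h) (arc? v) (out? v) (in? v)))) ⟩
    sum (λ v → # (same? v) + (# (out? v) + # (in? v)))
      ≡⟨ trans (∑-distrib-+ (λ v → # (same? v)) (λ v → # (out? v) + # (in? v)))
           (cong (sum (λ v → # (same? v)) +_) (∑-distrib-+ (λ v → # (out? v)) (λ v → # (in? v)))) ⟩
    sum (λ v → # (same? v)) + (sum (λ v → # (out? v)) + sum (λ v → # (in? v)))
      ≡⟨ cong (λ z → sum (λ v → # (same? v)) + (sum (λ v → # (out? v)) + z)) (#-swap in?) ⟩
    sum (λ v → # (same? v)) + (sum (λ v → # (out? v)) + sum (λ u → # (λ v → in? v u)))
     
        ≤⟨ +-mono-≤ (guarded (λ v u → clean? u ×-dec (colour u F.≟ colour v)) (λ {v} _ → small-classes (colour v)))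
           (+-mono-≤ (guarded target? d≤e) (guarded target? d≤e)) ⟩
    # Z? * (5 * s) + (# Z? * e + # Z? * e) ≡⟨ arith (# Z?) s e ⟩
    # Z? * (2 * e + 5 * s) ∎)
    where
    open ≤-Reasoning
    arith : ∀ z s e → z * (5 * s) + (z * e + z * e) ≡ z * (2 * e + 5 * s)
    arith = solve-∀
    same? : ∀ v u → Dec (Z v × Clean u × colour u ≡ colour v)
    same? v u = Z? v ×-dec clean? u ×-dec (colour u F.≟ colour v)
    out? : ∀ v u → Dec (Z v × Target v u)
    out? v u = Z? v ×-dec target? v u
    in? : ∀ v u → Dec (Z u × Target u v)
    in? v u = out? u v
    arc? : ∀ v u → Dec ((Z v × Target v u) ⊎ (Z u × Target u v))
    arc? v u = out? v u ⊎-dec in? v u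
    cases : ∀ v u → Z v × Z u × Conflict v u →
            (Z v × Clean u × colour u ≡ colour v) ⊎ (Z v × Target v u) ⊎ (Z u × Target u v)
    cases v u (zv , zu , inj₁ e) = inj₁ (zv , Z⊆ zu , sym e)
    cases v u (zv , zu , inj₂ fo) with total {v} {u} (λ { refl → proj₁ fo refl })
    ... | inj₁ vu = inj₂ (inj₁ (zv , Z⊆ zu , vu , fo))
    ... | inj₂ uv = inj₂ (inj₂ (zu , Z⊆ zv , uv , foreign-sym fo))
    guarded : ∀ {k} {Q : Fin N → Fin N → Set} (Q? : Decidable Q) → (∀ {v} → Z v → # (Q? v) ≤ k) →
              sum (λ v → # (λ u → Z? v ×-dec Q? v u)) ≤ # Z? * k
    guarded {k} Q? h = ≤-trans (sum-mono λ v → #-guard (Z? v) (Q? v) h)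
      (≤-reflexive (trans (sym (*-distribʳ-sum k (λ v → 𝟙 (Z? v)))) (cong (_* k) (sym (#-sum Z?)))))

  record Chain (Y : Fin N → Set) (m : ℕ) : Set where
    field
      {start end} : Fin N
      {rest}      : List (Fin N)
      {labels}    : List (Fin B)
      path        : Path f start end (start ∷ rest) labels
      labels↭     : colour end ∷ labels ↭ map colour (start ∷ rest)
      inside      : All Y (start ∷ rest)
      colours!    : Unique (map colour (start ∷ rest))
      size        : length (start ∷ rest) ≡ m

  -- A set without conflicts is a semicomplete digraph under the relation `E`, and its Hamiltonian
  -- path is a chain. The same holds for its subsets, so every length up to the size of the
  -- independent set is available.
  chains : ∀ e K {Y : Fin N → Set} (Y? : Decidable₁ Y) → (∀ {v} → Y v → Clean v) →
           (∀ {v} → Y v → # (target? v) ≤ e) → 2 * e + 5 * s ≤ K →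
           ∃ λ n → # Y? ≤ K * n × ∀ m → 1 ≤ m → m ≤ n → Chain Y m
  chains e K {Y} Y? Y⊆ d≤e e≤K
    = let I , I⊆Y , ind , count = independent conflict? (λ _ → inj₁ refl) K Y? sparse-part
      in length I , count , chain I I⊆Y ind
    where
    sparse-part : ∀ {Z : Fin N → Set} (Z? : Decidable₁ Z) → (∀ {v} → Z v → Y v) → ∃ Z →
                  ∃ λ v → Z v × # (λ u → Z? u ×-dec conflict? v u) ≤ K
    sparse-part Z? Z⊆Y point =
      let v , zv , le = sparse e Z? (Y⊆ ∘ Z⊆Y) (d≤e ∘ Z⊆Y) point in v , zv , ≤-trans le e≤K
    E : Fin N → Fin N → Set
    E y z = f y z ≡ colour y
    E? : Decidable E
    E? y z = f y z F.≟ colour y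
    compatible : ∀ {y z} → ¬ Conflict y z → colour y ≢ colour z × (E y z ⊎ E z y)
    compatible {y} {z} ¬c with E? y z | E? z y
    ... | yes e | _ = ¬c ∘ inj₁ , inj₁ e
    ... | no _ | yes e = ¬c ∘ inj₁ , inj₂ e
    ... | no ¬e | no ¬e′ = contradiction (inj₂ (¬c ∘ inj₁ , ¬e , ¬e′ ∘ trans (f-sym z y))) ¬c
    fromList : ∀ J → All Y J → AllPairs (λ v u → ¬ Conflict v u) J → 1 ≤ length J → Chain Y (length J)
    fromList (x ∷ xs) J⊆ ok _ =
      let y , ys , linked , p = hamiltonian E? x xs (AllPairs.map (proj₂ ∘ compatible) ok)
          z , cs , r , cs↭ = linked⇒path linked
      in record
      { path = r ; labels↭ = cs↭ ; inside = All-resp-↭ (↭-sym p) J⊆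
      ; colours! = unique-↭ (↭-sym (map⁺ colour p)) (AllPairs.map⁺ (AllPairs.map (proj₁ ∘ compatible) ok))
      ; size = ↭-length p }
    chain : ∀ I → All Y I → AllPairs (λ v u → ¬ Conflict v u) I → ∀ m → 1 ≤ m → m ≤ length I → Chain Y m
    chain I I⊆Y ind m 1≤m m≤ = subst (Chain Y) len (fromList (take m I) (All.take⁺ m I⊆Y) (AllPairs.take⁺ m ind)
      (≤-trans 1≤m (≤-reflexive (sym len))))
      where len = trans (length-take m I) (m≤n⇒m⊓n≡m m≤)

  target-colour : ∀ {v u} → Target v u → colour v ≢ colour u
  target-colour (_ , _ , c≢ , _) = c≢

  open Bipartition colour clean? target? target-colour public

  -- Collecting chains and turns for a fixed bipartition.

  module Side (σ : Vec Bool B) where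

    Good : Fin N → Set
    Good v = Clean v × Vec.lookup σ (colour v) ≡ true × # (target? v) ≤ 2 * # (far? σ v)

    g : Fin N → ℕ
    g v = # (far? σ v)

    -- δs, τs: the colours of the vertices on the chains and of the vertices where the chains turn;
    -- φs: the labels of the turning edges.
    record State : Set where
      field
        Ps        : List Bundle
        δs τs φs  : List (Fin B)
        vertices↭ : map colour (allVertices Ps) ↭ δs ++ τs
        reserved↭ : allReserved Ps ↭ δs ++ τs ++ φs
        δs!       : Unique δs
        τs!       : Unique τs
        φs!       : Unique φs
        δs-near   : All (λ γ → Vec.lookup σ γ ≡ true × ∃ λ w → Clean w × γ ≡ colour w) δs
        τs-far    : All (λ γ → Vec.lookup σ γ ≡ false × ∃ λ w → Clean w × γ ≡ colour w) τs
        φs-new    : All (λ γ → ∀ {w} → Clean w → γ ≢ colour w) φs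
        |τs|      : length τs ≡ length Ps
        |φs|      : length φs ≡ length Ps
        |Ps|      : length Ps ≤ length δs
      size : ℕ
      size = length δs
      turns : ℕ
      turns = length Ps

    open State

    -- Chain colours and turn colours lie on opposite sides, and turning labels are colours of no
    -- clean vertex, so all reserved colours are distinct. Vertices are distinct because their
    -- colours are. There are at most as many turns as chain vertices, which gives the bound
    -- `3 * (10 * t)`.
    finish : (S : State) → 5 * t ≤ size S → size S ≤ 10 * t → RainbowPath f t
    finish S big small = family⇒rainbow {Ps = Ps S} 1≤t (record
      { vertices! = Unique.map⁻ (unique-↭ (↭-sym (vertices↭ S)) (Unique.++⁺ (δs! S) (τs! S) δτ))
      ; reserved! = unique-↭ (↭-sym (reserved↭ S)) (Unique.++⁺ (δs! S) (Unique.++⁺ (τs! S) (φs! S) τφ) δτφ)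
      ; bounded = bound })
      (≤-trans big (≤-trans (m≤m+n _ (length (τs S))) (≤-reflexive (sym |vs|))))
      where
      δτ : ∀ {γ} → γ ∈ δs S × γ ∈ τs S → _
      δτ (a , b) with trans (sym (proj₁ (All.lookup (δs-near S) a))) (proj₁ (All.lookup (τs-far S) b))
      ... | ()
      τφ : ∀ {γ} → γ ∈ τs S × γ ∈ φs S → _
      τφ (a , b) = let _ , w , cw , e = All.lookup (τs-far S) a in All.lookup (φs-new S) b cw e
      δφ : ∀ {γ} → γ ∈ δs S × γ ∈ φs S → _
      δφ (a , b) = let _ , w , cw , e = All.lookup (δs-near S) a in All.lookup (φs-new S) b cw e
      δτφ : ∀ {γ} → γ ∈ δs S × γ ∈ τs S ++ φs S → _
      δτφ (a , b) = [ (λ h → δτ (a , h)) , (λ h → δφ (a , h)) ]′ (∈-++⁻ (τs S) b)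
      |vs| : length (allVertices (Ps S)) ≡ size S + length (τs S)
      |vs| = trans (sym (length-map colour (allVertices (Ps S)))) (trans (↭-length (vertices↭ S)) (length-++ (δs S)))
      bound : length (allVertices (Ps S)) + length (Ps S) ≤ 30 * t
      bound = begin
        length (allVertices (Ps S)) + length (Ps S) ≡⟨ cong₂ _+_ (trans |vs| (cong (size S +_) (|τs| S))) refl ⟩
        size S + turns S + turns S ≤⟨ +-mono-≤ (+-monoʳ-≤ (size S) (|Ps| S)) (|Ps| S) ⟩
        size S + size S + size S ≡⟨ arith₁ (size S) ⟩
        3 * size S ≤⟨ *-monoʳ-≤ 3 small ⟩
        3 * (10 * t) ≡⟨ arith₂ t ⟩
        30 * t ∎
        where
        open ≤-Reasoning
        arith₁ : ∀ x → x + x + x ≡ 3 * x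
        arith₁ = solve-∀
        arith₂ : ∀ t → 3 * (10 * t) ≡ 30 * t
        arith₂ = solve-∀

    Fresh : State → (Fin N → Set) → Fin N → Set
    Fresh S Y v = Y v × colour v ∉ δs S

    fresh? : ∀ S {Y : Fin N → Set} → Decidable₁ Y → Decidable₁ (Fresh S Y)
    fresh? S Y? v = Y? v ×-dec ¬? (colour v ∈? δs S)

    -- Each earlier turn blocks at most `5 * s` targets through its vertex colour and at most `s`
    -- through its label.
    free-target : ∀ (S : State) v → 6 * s * turns S < g v →
                  ∃ λ u → (Target v u × Vec.lookup σ (colour u) ≡ false) × colour u ∉ τs S × f v u ∉ φs S
    free-target S v big =
      let u , far , unused = pick (far? σ v) used? (≤-<-trans few big)
      in u , far , (λ h → unused (inj₁ (proj₁ (proj₁ far) , h))) , λ h → unused (inj₂ (proj₁ (proj₂ (proj₁ far)) , h))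
      where
      in-class? : ∀ u → Dec (Clean u × colour u ∈ τs S)
      in-class? u = clean? u ×-dec (colour u ∈? τs S)
      in-label? : ∀ u → Dec (v ⟶ u × f v u ∈ φs S)
      in-label? u = (v ⟶? u) ×-dec (f v u ∈? φs S)
      used? : ∀ u → Dec ((Clean u × colour u ∈ τs S) ⊎ (v ⟶ u × f v u ∈ φs S))
      used? u = in-class? u ⊎-dec in-label? u
      few : # used? ≤ 6 * s * turns S
      few = begin
        # used? ≤⟨ #-⊎ (λ _ h → h) used? in-class? in-label? ⟩
        # in-class? + # in-label? ≤⟨ +-mono-≤ (#-colours clean? colour small-classes (τs S))
                                              (#-colours (v ⟶?_) (f v) (outdegree v) (φs S)) ⟩
        5 * s * length (τs S) + s * length (φs S) ≡⟨ cong₂ (λ a b → 5 * s * a + s * b) (|τs| S) (|φs| S) ⟩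
        5 * s * turns S + s * turns S ≡⟨ arith s (turns S) ⟩
        6 * s * turns S ∎
        where
        open ≤-Reasoning
        arith : ∀ s k → 5 * s * k + s * k ≡ 6 * s * k
        arith = solve-∀

    -- The chain is prolonged at its start by an edge to a free target `u`. Reserving the colour of
    -- `end` completes the chain labels to the colours of all chain vertices; the other new reserved
    -- colours are that of `u` and the label of the turning edge.
    add : ∀ (S : State) {Y m} → (∀ {v} → Y v → Good v × 6 * s * turns S < g v) → Chain (Fresh S Y) m → 1 ≤ m →
          ∃ λ S′ → (∀ {γ} → γ ∈ δs S → γ ∈ δs S′) × size S′ ≡ m + size S × turns S′ ≡ suc (turns S)
    add S {Y} {m} good C 1≤m = S′ , ∈-++⁺ʳ (map colour (start ∷ rest))
      , trans (length-++ (map colour (start ∷ rest))) (cong (_+ size S) |δ|) , refl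
      where
      open Chain C renaming (size to length≡m)
      clean : ∀ {v} → Fresh S Y v → Clean v
      clean (y , _) = proj₁ (proj₁ (good y))
      turn = free-target S start (proj₂ (good (proj₁ (All.head inside))))
      u = proj₁ turn
      u-clean : Clean u
      u-clean = proj₁ (proj₁ (proj₁ (proj₂ turn)))
      u-foreign : Foreign f colour start u
      u-foreign = proj₂ (proj₂ (proj₁ (proj₁ (proj₂ turn))))
      u-far = proj₂ (proj₁ (proj₂ turn))
      end-clean : Clean end
      end-clean = clean (All.lookup inside (path-end path))
      P : Bundle
      P = bundle (u ∷ path) (clean-lexical u-clean) (clean-lexical end-clean)
      |δ| : length (map colour (start ∷ rest)) ≡ m
      |δ| = trans (length-map colour (start ∷ rest)) length≡m
      new-δ : List (Fin B)
      new-δ = map colour (start ∷ rest)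
      S′ : State
      S′ = record
        { Ps = P ∷ Ps S
        ; δs = new-δ ++ δs S
        ; τs = colour u ∷ τs S
        ; φs = f u start ∷ φs S
        ; vertices↭ = ↭-trans (↭-reflexive (cong (colour u ∷_) (map-++ colour (start ∷ rest) (allVertices (Ps S)))))
            (↭-trans (prep _ (++⁺ˡ new-δ (vertices↭ S)))
              (solve 4 (λ a b c d → a ⊕ (b ⊕ (c ⊕ d)) ⊜ (b ⊕ c) ⊕ (a ⊕ d)) refl (colour u ∷ []) new-δ (δs S) (τs S)))
        ; reserved↭ = ↭-trans (prep _ (++⁺ (↭-trans (swap _ _ refl) (prep _ labels↭)) (reserved↭ S)))
            (solve 6 (λ a φ b c d e → a ⊕ ((φ ⊕ b) ⊕ (c ⊕ (d ⊕ e))) ⊜ (b ⊕ c) ⊕ ((a ⊕ d) ⊕ (φ ⊕ e))) refl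
              (colour u ∷ []) (f u start ∷ []) new-δ (δs S) (τs S) (φs S))
        ; δs! = Unique.++⁺ colours! (δs! S) disjoint
        ; τs! = ∉⇒All (proj₁ (proj₂ (proj₂ turn))) ∷ τs! S
        ; φs! = ∉⇒All (proj₂ (proj₂ (proj₂ turn)) ∘ subst (_∈ φs S) (f-sym u start)) ∷ φs! S
        ; δs-near = All.++⁺ (All.map⁺ (All.map (λ y → proj₁ (proj₂ (proj₁ (good (proj₁ y)))) , _ , clean y , refl) inside)) (δs-near S)
        ; τs-far = (u-far , _ , u-clean , refl) ∷ τs-far S
        ; φs-new = (λ {w} cw e → foreign-label (clean (All.head inside)) u-clean u-foreign cw (trans (f-sym start u) e)) ∷ φs-new S
        ; |τs| = cong suc (|τs| S)
        ; |φs| = cong suc (|φs| S)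
        ; |Ps| = ≤-trans (+-mono-≤ (≤-trans 1≤m (≤-reflexive (sym |δ|))) (|Ps| S)) (≤-reflexive (sym (length-++ new-δ)))
        }
        where
        disjoint : ∀ {γ} → γ ∈ new-δ × γ ∈ δs S → _
        disjoint (a , b) with ∈-map⁻ colour a
        ... | v , v∈ , refl = proj₂ (All.lookup inside v∈) b

    -- At most 2 · 2^i turns are made up to level i, and each blocks at most 6 s targets of a vertex.
    module Level (i : ℕ) where
      q : ℕ
      q = s * 2 ^ i

      Band : Fin N → Set
      Band v = Good v × 12 * q < g v × g v ≤ 24 * q

      band? : Decidable₁ Band
      band? v = good? σ v ×-dec (_ <? _) ×-dec (_ ≤? _)

      -- In each of `n` steps the new chain takes at least one part in `102 * q` of the fresh band
      -- vertices. The fresh set only shrinks, so in `gain` its final size serves for all steps.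
      record Extension (S : State) (n : ℕ) : Set where
        field
          next     : State
          δs⊆      : ∀ {γ} → γ ∈ δs S → γ ∈ δs next
          small    : size next < 5 * t
          turns≤   : turns next ≤ n + turns S
          gain     : 102 * q * size S + n * # (fresh? next band?) ≤ 102 * q * size next

      degree : ∀ {v} → Band v → # (target? v) ≤ 48 * q
      degree {v} ((_ , _ , d≤) , _ , g≤) = ≤-trans d≤ (≤-trans (*-monoʳ-≤ 2 g≤) (≤-reflexive (arith q)))
        where
        arith : ∀ q → 2 * (24 * q) ≡ 48 * q
        arith = solve-∀

      conflicts≤ : 2 * (48 * q) + 5 * s ≤ 102 * q
      conflicts≤ = begin
        -- This uses `s ≤ q`, valid because `2 ^ i` is at least 1.
        2 * (48 * q) + 5 * s ≤⟨ +-monoʳ-≤ (2 * (48 * q)) (*-monoʳ-≤ 5 (m≤m*n s (2 ^ i) ⦃ m^n≢0 2 i ⦄)) ⟩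
        2 * (48 * q) + 5 * q ≤⟨ m≤m+n _ q ⟩
        2 * (48 * q) + 5 * q + q ≡⟨ arith q ⟩
        102 * q ∎
        where
        open ≤-Reasoning
        arith : ∀ q → 2 * (48 * q) + 5 * q + q ≡ 102 * q
        arith = solve-∀

      module _ (S : State) (small : size S < 5 * t) (few : turns S < 2 * 2 ^ i) where

        turnable : ∀ {v} → Band v → Good v × 6 * s * turns S < g v
        turnable {v} (good , low , _) = good , ≤-<-trans (begin
          -- The lower limit `12 * q` of the band is exactly what `2 * 2 ^ i` turns can block.
          6 * s * turns S ≤⟨ *-monoʳ-≤ (6 * s) (<⇒≤ few) ⟩
          6 * s * (2 * 2 ^ i) ≡⟨ arith s (2 ^ i) ⟩
          12 * q ∎) low
          where
          open ≤-Reasoning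
          arith : ∀ s p → 6 * s * (2 * p) ≡ 12 * (s * p)
          arith = solve-∀

        1≤5t : 1 ≤ 5 * t
        1≤5t = ≤-trans 1≤t (m≤n*m t 5)

        size≤ : ∀ {m x} → m ≤ 5 * t → x ≡ m + size S → x ≤ 10 * t
        size≤ {m} le refl = ≤-trans (+-mono-≤ le (<⇒≤ small)) (≤-reflexive (arith t))
          where
          arith : ∀ t → 5 * t + 5 * t ≡ 10 * t
          arith = solve-∀

        Chains : ℕ → Set
        Chains n = ∀ m → 1 ≤ m → m ≤ n → Chain (Fresh S Band) m

        extend-by : ∀ n → 1 ≤ n → n ≤ 5 * t → # (fresh? S band?) ≤ 102 * q * n → Chains n →
                    RainbowPath f t ⊎ Extension S 1
        extend-by n 1≤n n≤5t count chain =
          let S′ , δs⊆ , size≡ , turns≡ = add S turnable (chain n 1≤n ≤-refl) 1≤n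
          in cases S′ δs⊆ size≡ turns≡ (_ ≤? _)
          where
          open ≤-Reasoning
          arith : ∀ k x n → k * x + k * n ≡ k * (n + x)
          arith = solve-∀
          cases : ∀ S′ → (∀ {γ} → γ ∈ δs S → γ ∈ δs S′) → size S′ ≡ n + size S → turns S′ ≡ suc (turns S) →
                  Dec (5 * t ≤ size S′) → RainbowPath f t ⊎ Extension S 1
          cases S′ δs⊆ size≡ turns≡ (yes big) = inj₁ (finish S′ big (size≤ n≤5t size≡))
          cases S′ δs⊆ size≡ turns≡ (no ¬big) = inj₂ (record
            { next = S′ ; δs⊆ = δs⊆ ; small = ≰⇒> ¬big ; turns≤ = ≤-reflexive turns≡
            ; gain = begin
              102 * q * size S + 1 * # (fresh? S′ band?)
                ≤⟨ +-monoʳ-≤ (102 * q * size S) (≤-trans (≤-reflexive (*-identityˡ (# (fresh? S′ band?))))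
                     (#-mono (λ v (b , ∉) → b , ∉ ∘ δs⊆) (fresh? S′ band?) (fresh? S band?))) ⟩
              102 * q * size S + # (fresh? S band?) ≤⟨ +-monoʳ-≤ (102 * q * size S) count ⟩
              102 * q * size S + 102 * q * n ≡⟨ arith (102 * q) (size S) n ⟩
              102 * q * (n + size S) ≡⟨ cong (102 * q *_) (sym size≡) ⟩
              102 * q * size S′ ∎ })

        -- With `n = 0` no fresh band vertex is left and the state stays. A longest chain of length
        -- at most `5 * t` is added whole. A longer one is cut to `5 * t`, which completes the
        -- family at once while keeping its size at most `10 * t`.
        decide : ∀ n → # (fresh? S band?) ≤ 102 * q * n → Chains n → Dec (n ≤ 5 * t) →
                 RainbowPath f t ⊎ Extension S 1
        decide zero count chain _ = inj₂ (record
          { next = S ; δs⊆ = λ h → h ; small = small ; turns≤ = n≤1+n _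
          ; gain = ≤-reflexive (trans (cong (102 * q * size S +_) (trans (*-identityˡ _)
              (n≤0⇒n≡0 (≤-trans count (≤-reflexive (*-zeroʳ (102 * q))))))) (+-identityʳ _)) })
        decide (suc n) count chain (yes n≤5t) = extend-by (suc n) (s≤s z≤n) n≤5t count chain
        decide (suc n) count chain (no n≰5t) =
          let S′ , δs⊆ , size≡ , _ = add S turnable (chain (5 * t) 1≤5t (<⇒≤ (≰⇒> n≰5t))) 1≤5t
          in inj₁ (finish S′ (≤-trans (m≤m+n (5 * t) (size S)) (≤-reflexive (sym size≡))) (size≤ ≤-refl size≡))

        step : RainbowPath f t ⊎ Extension S 1
        step = let n , count , chain = chains (48 * q) (102 * q) (fresh? S band?)
                                         (λ y → proj₁ (proj₁ (proj₁ y))) (λ y → degree (proj₁ y)) conflicts≤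
               in decide n count chain (_ ≤? _)

      open Extension

      compose : ∀ {S n} (X : Extension S 1) → Extension (next X) n → Extension S (suc n)
      compose {S} {n} X Y = record
        { next = next Y ; δs⊆ = δs⊆ Y ∘ δs⊆ X ; small = small Y
        ; turns≤ = ≤-trans (turns≤ Y) (≤-trans (+-monoʳ-≤ n (turns≤ X)) (≤-reflexive (+-suc n (turns S))))
        ; gain = begin
          102 * q * size S + (y₂ + n * y₂) ≡⟨ sym (+-assoc (102 * q * size S) y₂ (n * y₂)) ⟩
          102 * q * size S + y₂ + n * y₂ ≤⟨ +-monoˡ-≤ (n * y₂) (+-monoʳ-≤ (102 * q * size S) shrink) ⟩
          102 * q * size S + 1 * y₁ + n * y₂ ≤⟨ +-monoˡ-≤ (n * y₂) (gain X) ⟩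
          102 * q * size (next X) + n * y₂ ≤⟨ gain Y ⟩
          102 * q * size (next Y) ∎ }
        where
        open ≤-Reasoning
        y₁ = # (fresh? (next X) band?)
        y₂ = # (fresh? (next Y) band?)
        shrink : y₂ ≤ 1 * y₁
        shrink = ≤-trans (#-mono (λ v (b , ∉) → b , ∉ ∘ δs⊆ Y) (fresh? (next Y) band?) (fresh? (next X) band?))
          (≤-reflexive (sym (*-identityˡ y₁)))

      steps : ∀ n S → size S < 5 * t → n + turns S ≤ 2 * 2 ^ i → RainbowPath f t ⊎ Extension S n
      steps zero S small few = inj₂ (record
        { next = S ; δs⊆ = λ h → h ; small = small ; turns≤ = ≤-refl ; gain = ≤-reflexive (+-identityʳ _) })
      steps (suc n) S small few = continue (step S small (≤-trans (s≤s (m≤n+m (turns S) n)) few))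
        where
        continue : RainbowPath f t ⊎ Extension S 1 → RainbowPath f t ⊎ Extension S (suc n)
        continue (inj₁ done) = inj₁ done
        continue (inj₂ X) = map₂ (compose X) (steps n (next X) (Extension.small X)
          (≤-trans (+-monoʳ-≤ n (turns≤ X)) (≤-trans (≤-reflexive (+-suc n (turns S))) few)))

      record Raised (S : State) : Set where
        field
          next     : State
          δs⊆      : ∀ {γ} → γ ∈ δs S → γ ∈ δs next
          small    : size next < 5 * t
          turns<   : suc (turns next) ≤ 2 ^ suc i
          gain     : 102 * s * size S + # (fresh? next band?) ≤ 102 * s * size next

      -- The factor `2 ^ i` in `q` is cancelled by making `2 ^ i` steps, so the gain per chain
      -- vertex no longer depends on the level. Fewer than `2 ^ i` earlier turns and `2 ^ i` new
      -- ones stay below `2 ^ suc i`.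
      level : ∀ S → size S < 5 * t → suc (turns S) ≤ 2 ^ i → RainbowPath f t ⊎ Raised S
      level S small few = map₂ raise (steps (2 ^ i) S small
        (≤-trans (+-monoʳ-≤ (2 ^ i) (≤-trans (n≤1+n _) few)) (≤-reflexive (cong (2 ^ i +_) (sym (+-identityʳ (2 ^ i)))))))
        where
        open ≤-Reasoning
        arith₁ : ∀ p s x y → p * (102 * s * x + y) ≡ 102 * (s * p) * x + p * y
        arith₁ = solve-∀
        arith₂ : ∀ p s x → 102 * (s * p) * x ≡ p * (102 * s * x)
        arith₂ = solve-∀
        raise : Extension S (2 ^ i) → Raised S
        raise X = record
          { next = next X ; δs⊆ = δs⊆ X ; small = Extension.small X
          ; turns< = ≤-trans (s≤s (turns≤ X)) (≤-trans (≤-reflexive (sym (+-suc (2 ^ i) (turns S))))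
              (≤-trans (+-monoʳ-≤ (2 ^ i) few) (≤-reflexive (cong (2 ^ i +_) (sym (+-identityʳ (2 ^ i)))))))
          ; gain = *-cancelˡ-≤ (2 ^ i) ⦃ m^n≢0 2 i ⦄ (begin
              2 ^ i * (102 * s * size S + # (fresh? (next X) band?))
                ≡⟨ arith₁ (2 ^ i) s (size S) (# (fresh? (next X) band?)) ⟩
              102 * (s * 2 ^ i) * size S + 2 ^ i * # (fresh? (next X) band?) ≤⟨ gain X ⟩
              102 * (s * 2 ^ i) * size (next X) ≡⟨ arith₂ (2 ^ i) s (size (next X)) ⟩
              2 ^ i * (102 * s * size (next X)) ∎) }

    Above : Fin N → Set
    Above v = Good v × 12 * s < g v

    above? : Decidable₁ Above
    above? v = good? σ v ×-dec (_ <? _)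

    Between : ℕ → Fin N → Set
    Between i v = Above v × g v ≤ 12 * (s * 2 ^ i)

    between? : ∀ i → Decidable₁ (Between i)
    between? i v = above? v ×-dec (_ ≤? _)

    -- The invariant after the levels below `i`: the gains telescope, so one bound in terms of the
    -- chain size covers all bands treated so far.
    record Climbed (i : ℕ) : Set where
      field
        state  : State
        small  : size state < 5 * t
        turns< : suc (turns state) ≤ 2 ^ i
        covers : # (fresh? state (between? i)) ≤ 102 * s * size state

    ground : Climbed 0
    ground = record { state = empty ; small = ≤-trans 1≤t (m≤n*m t 5) ; turns< = ≤-refl
                    ; covers = ≤-trans (≤-reflexive (#-empty (fresh? empty (between? 0)) none)) z≤n }
      where
      empty : State
      empty = record { Ps = [] ; δs = [] ; τs = [] ; φs = [] ; vertices↭ = refl ; reserved↭ = refl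
        ; δs! = [] ; τs! = [] ; φs! = [] ; δs-near = [] ; τs-far = [] ; φs-new = [] ; |τs| = refl ; |φs| = refl ; |Ps| = z≤n }
      none : ∀ v → ¬ Fresh empty (Between 0) v
      -- At level 0 the lower and the upper limit coincide.
      none v (((_ , low) , high) , _) = <⇒≱ low (≤-trans high (≤-reflexive (cong (12 *_) (*-identityʳ s))))

    climb : ∀ i (X : Climbed i) → Level.Raised i (Climbed.state X) → Climbed (suc i)
    climb i X Y = record { state = next ; small = small ; turns< = turns< ; covers = begin
      # (fresh? next (between? (suc i)))
        ≤⟨ #-⊎ cases (fresh? next (between? (suc i))) (fresh? S (between? i)) (fresh? next (Level.band? i)) ⟩
      # (fresh? S (between? i)) + # (fresh? next (Level.band? i)) ≤⟨ +-monoˡ-≤ _ (Climbed.covers X) ⟩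
      102 * s * size S + # (fresh? next (Level.band? i)) ≤⟨ gain ⟩
      102 * s * size next ∎ }
      where
      open ≤-Reasoning
      open Level.Raised Y
      S = Climbed.state X
      arith : ∀ s p → 12 * (s * (2 * p)) ≡ 24 * (s * p)
      arith = solve-∀
      cases : ∀ v → Fresh next (Between (suc i)) v → Fresh S (Between i) v ⊎ Fresh next (Level.Band i) v
      cases v ((above , high) , ∉) = split (_ ≤? _)
        where
        split : Dec (g v ≤ 12 * (s * 2 ^ i)) → Fresh S (Between i) v ⊎ Fresh next (Level.Band i) v
        split (yes low) = inj₁ ((above , low) , ∉ ∘ δs⊆)
        split (no ¬low) = inj₂ ((proj₁ above , ≰⇒> ¬low , ≤-trans high (≤-reflexive (arith s (2 ^ i)))) , ∉)

    levels : ∀ i → RainbowPath f t ⊎ Climbed i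
    levels zero    = inj₂ ground
    levels (suc i) = [ inj₁ , (λ X → map₂ (climb i X)
      (Level.level i (Climbed.state X) (Climbed.small X) (Climbed.turns< X))) ]′ (levels i)

    Below : Fin N → Set
    Below v = Good v × g v ≤ 12 * s

    below? : Decidable₁ Below
    below? v = good? σ v ×-dec (_ ≤? _)

    -- No turn is needed here: these vertices have so few conflicts that one chain is long enough.
    below : RainbowPath f t ⊎ # below? ≤ 53 * s * t
    below = let n , count , chain = chains (24 * s) (53 * s) below? (λ y → proj₁ (proj₁ y))
                    (λ { ((_ , _ , d≤) , g≤) → ≤-trans d≤ (≤-trans (*-monoʳ-≤ 2 g≤) (≤-reflexive (arith₁ s))) })
                    (≤-reflexive (arith₂ s))
            in cases n count chain (_ ≤? _)
      where
      arith₁ : ∀ s → 2 * (12 * s) ≡ 24 * s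
      arith₁ = solve-∀
      arith₂ : ∀ s → 2 * (24 * s) + 5 * s ≡ 53 * s
      arith₂ = solve-∀
      single : Chain Below t → RainbowPath f t
      single C = rainbow path (Unique.map⁻ colours!) (AllPairs.tail (unique-↭ (↭-sym labels↭) colours!)) (≤-reflexive (sym length≡t))
        where open Chain C renaming (size to length≡t)
      cases : ∀ n → # below? ≤ 53 * s * n → (∀ m → 1 ≤ m → m ≤ n → Chain Below m) → Dec (t ≤ n) →
              RainbowPath f t ⊎ # below? ≤ 53 * s * t
      cases n count chain (yes long)  = inj₁ (single (chain t 1≤t long))
      cases n count chain (no short) = inj₂ (≤-trans count (*-monoʳ-≤ (53 * s) (<⇒≤ (≰⇒> short))))

    -- Good vertices have few targets (at most `53 * s * t` of them), or share a colour with a chain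
    -- (at most `5 * s` for each of fewer than `5 * t` colours), or are fresh after the last level
    -- (at most `102 * s * (5 * t)`). This makes 588 · s · t. Level `N` is the last because
    -- `g v ≤ N ≤ 2 ^ N`.
    many-good : 600 * (s * t) ≤ # (good? σ) → RainbowPath f t
    many-good many = [ (λ done → done) , (λ few-below →
                     [ (λ done → done) , (λ X → contradiction many (<⇒≱ (too-few few-below X))) ]′ (levels N)) ]′ below
      where
      open ≤-Reasoning
      arith : ∀ s t → 53 * s * t + (5 * s * (5 * t) + 102 * s * (5 * t)) + 12 * (s * t) ≡ 600 * (s * t)
      arith = solve-∀
      n≤2^n : ∀ n → n ≤ 2 ^ n
      n≤2^n zero = z≤n
      n≤2^n (suc n) = ≤-trans (+-mono-≤ (m^n>0 2 n) (n≤2^n n)) (≤-reflexive (cong (2 ^ n +_) (sym (+-identityʳ (2 ^ n)))))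
      top : ∀ v → g v ≤ 12 * (s * 2 ^ N)
      top v = ≤-trans (#≤n (far? σ v)) (≤-trans (n≤2^n N) (≤-trans (m≤n*m (2 ^ N) s ⦃ >-nonZero 1≤s ⦄) (m≤n*m (s * 2 ^ N) 12)))
      too-few : # below? ≤ 53 * s * t → Climbed N → # (good? σ) < 600 * (s * t)
      too-few few-below X = begin-strict
        # (good? σ) ≤⟨ #-⊎ cases (good? σ) below? (λ v → used? v ⊎-dec fresh? S (between? N) v) ⟩
        # below? + # (λ v → used? v ⊎-dec fresh? S (between? N) v)
         
            ≤⟨ +-monoʳ-≤ (# below?) (#-⊎ (λ _ h → h) (λ v → used? v ⊎-dec fresh? S (between? N) v) used? (fresh? S (between? N))) ⟩
        # below? + (# used? + # (fresh? S (between? N)))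
          ≤⟨ +-mono-≤ few-below (+-mono-≤ (#-colours clean? colour small-classes (δs S)) bound) ⟩
        53 * s * t + (5 * s * size S + 102 * s * size S)
         
            ≤⟨ +-monoʳ-≤ (53 * s * t) (+-mono-≤ (*-monoʳ-≤ (5 * s) (<⇒≤ small)) (*-monoʳ-≤ (102 * s) (<⇒≤ small))) ⟩
        53 * s * t + (5 * s * (5 * t) + 102 * s * (5 * t))
          <⟨ m<m+n _ (*-mono-≤ (s≤s {0} {11} z≤n) (*-mono-≤ 1≤s 1≤t)) ⟩
        53 * s * t + (5 * s * (5 * t) + 102 * s * (5 * t)) + 12 * (s * t) ≡⟨ arith s t ⟩
        600 * (s * t) ∎
        where
        open Climbed X renaming (state to S; covers to bound)
        used? : ∀ v → Dec (Clean v × colour v ∈ δs S)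
        used? v = clean? v ×-dec (colour v ∈? δs S)
        cases : ∀ v → Good v → Below v ⊎ ((Clean v × colour v ∈ δs S) ⊎ Fresh S (Between N) v)
        cases v good = split (_ ≤? _) (_ ∈? _)
          where
          split : Dec (g v ≤ 12 * s) → Dec (colour v ∈ δs S) →
                  Below v ⊎ ((Clean v × colour v ∈ δs S) ⊎ Fresh S (Between N) v)
          split (yes low) _ = inj₁ (good , low)
          split (no _) (yes ∈δ) = inj₂ (inj₁ (proj₁ good , ∈δ))
          split (no ¬low) (no ∉δ) = inj₂ (inj₂ (((good , ≰⇒> ¬low) , top v) , ∉δ))

  many-clean : 2400 * (s * t) ≤ # clean? → RainbowPath f t
  many-clean many = let σ , le = balanced in Side.many-good σ (*-cancelˡ-≤ 4 (≤-trans (≤-reflexive (arith (s * t))) (≤-trans many le)))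
    where
    arith : ∀ x → 4 * (600 * x) ≡ 2400 * x
    arith = solve-∀

-- A maximal family of foreign edges.

module Harvest {N B s t : ℕ} (1≤s : 1 ≤ s) (1≤t : 1 ≤ t) (N-large : 12000 * (s * t) ≤ N)
  {f : Fin N → Fin N → Fin B} (f-sym : ∀ u v → f u v ≡ f v u)
  {_⟶_ : Fin N → Fin N → Set} (_⟶?_ : Decidable _⟶_)
  (total : ∀ {u v} → u ≢ v → u ⟶ v ⊎ v ⟶ u)
  (outdegree : ∀ v γ → # (λ w → (v ⟶? w) ×-dec (f v w F.≟ γ)) ≤ s)
  {colour : Fin N → Fin B}
  {Lex : Fin N → Fin N → Set} (lex? : Decidable Lex) (lex-colour : ∀ {w v} → Lex w v → f v w ≡ colour w)
  (β<N : 75 * (30 * t) < N)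
  (lexical? : Decidable₁ (IsLexical lex?))
  (small-classes : ∀ γ → # (λ w → lexical? w ×-dec (colour w F.≟ γ)) ≤ 5 * s)
  (many-lexical : N ≤ 4 * # lexical? + (1600 * (s * t) + 2))
  where

  open Merge f-sym lex? lex-colour (30 * t) β<N

  1≤st : 1 ≤ s * t
  1≤st = *-mono-≤ 1≤s 1≤t

  record Matching (n : ℕ) : Set where
    field
      Ps         : List Bundle
      vertices!  : Unique (allVertices Ps)
      reserved!  : Unique (allReserved Ps)
      |Ps|       : length Ps ≡ n
      |vertices| : length (allVertices Ps) ≡ 2 * n
      |reserved| : length (allReserved Ps) ≡ 3 * n
      owned      : ∀ {v} → v ∈ allVertices Ps → colour v ∈ allReserved Ps

  open Matching

  Extendable : ∀ {n} → Matching n → Fin N → Fin N → Set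
  Extendable M u v = IsLexical lex? u × IsLexical lex? v × Foreign f colour u v ×
    colour u ∉ allReserved (Ps M) × colour v ∉ allReserved (Ps M) × f u v ∉ allReserved (Ps M)

  extendable? : ∀ {n} (M : Matching n) u v → Dec (Extendable M u v)
  extendable? M u v = lexical? u ×-dec lexical? v ×-dec foreign? f colour u v ×-dec
    ¬? (_ ∈? _) ×-dec ¬? (_ ∈? _) ×-dec ¬? (_ ∈? _)

  extend : ∀ {n} (M : Matching n) {u v} → Extendable M u v → Matching (suc n)
  extend {n} M {u} {v} (lu , lv , (c≢ , ≢cu , ≢cv) , cu∉ , cv∉ , f∉) = record
    { Ps = bundle (u ∷ [ v ]) lu lv ∷ Ps M
    ; vertices! = (u≢v ∷ ∉⇒All (cu∉ ∘ owned M)) ∷ ∉⇒All (cv∉ ∘ owned M) ∷ vertices! M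
    ; reserved! = (c≢ ∷ ≢cu ∘ sym ∷ ∉⇒All cu∉) ∷ (≢cv ∘ sym ∷ ∉⇒All cv∉) ∷ ∉⇒All f∉ ∷ reserved! M
    ; |Ps| = cong suc (|Ps| M)
    ; |vertices| = trans (cong (2 +_) (|vertices| M)) (arith₁ n)
    ; |reserved| = trans (cong (3 +_) (|reserved| M)) (arith₂ n)
    ; owned = λ { (here refl) → here refl ; (there (here refl)) → there (here refl)
                ; (there (there h)) → there (there (there (owned M h))) } }
    where
    u≢v : u ≢ v
    u≢v refl = c≢ refl
    arith₁ : ∀ n → 2 + 2 * n ≡ 2 * suc n
    arith₁ = solve-∀
    arith₂ : ∀ n → 3 + 3 * n ≡ 3 * suc n
    arith₂ = solve-∀

  Stuck : ℕ → Set
  Stuck n = ∃ λ m → m ≤ n × ∃ λ (M : Matching m) → ∀ u v → ¬ Extendable M u v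

  harvest : ∀ n → Matching n ⊎ Stuck n
  harvest zero = inj₁ (record { Ps = [] ; vertices! = [] ; reserved! = [] ; |Ps| = refl ; |vertices| = refl ; |reserved| = refl ; owned = λ () })
  harvest (suc n) = [ try , (λ (m , m≤n , rest) → inj₂ (m , m≤n⇒m≤1+n m≤n , rest)) ]′ (harvest n)
    where
    try : Matching n → Matching (suc n) ⊎ Stuck (suc n)
    try M = cases (F.any? λ u → F.any? λ v → extendable? M u v)
      where
      cases : Dec (∃ λ u → ∃ λ v → Extendable M u v) → Matching (suc n) ⊎ Stuck (suc n)
      cases (yes (_ , _ , ext)) = inj₁ (extend M ext)
      cases (no none) = inj₂ (n , n≤1+n n , M , λ u v ext → none (u , v , ext))

  -- The `3 * t` edges have `6 * t` vertices, at least the `5 * t` required.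
  full : Matching (3 * t) → RainbowPath f t
  full M = family⇒rainbow {Ps = Ps M} 1≤t
    (record { vertices! = vertices! M ; reserved! = reserved! M ; bounded = begin
      length (allVertices (Ps M)) + length (Ps M) ≡⟨ cong₂ _+_ (|vertices| M) (|Ps| M) ⟩
      2 * (3 * t) + 3 * t ≤⟨ m≤m+n _ (21 * t) ⟩
      2 * (3 * t) + 3 * t + 21 * t ≡⟨ arith₁ t ⟩
      30 * t ∎ })
    (begin
      5 * t ≤⟨ m≤m+n (5 * t) t ⟩
      5 * t + t ≡⟨ arith₂ t ⟩
      2 * (3 * t) ≡⟨ sym (|vertices| M) ⟩
      length (allVertices (Ps M)) ∎)
    where
    open ≤-Reasoning
    arith₁ : ∀ t → 2 * (3 * t) + 3 * t + 21 * t ≡ 30 * t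
    arith₁ = solve-∀
    arith₂ : ∀ t → 5 * t + t ≡ 2 * (3 * t)
    arith₂ = solve-∀

  -- Lexical vertices with a reserved colour are removed. If a foreign edge between clean vertices
  -- had the colour of a clean vertex, that colour would not be reserved and the edge would extend
  -- the matching. At most `9 * t` colours are reserved, so at most `45 * (s * t)` vertices are
  -- lost.
  stuck : Stuck (3 * t) → RainbowPath f t
  stuck (m , m≤3t , M , maximal) = many-clean many
    where
    open ≤-Reasoning
    Clean : Fin N → Set
    Clean v = IsLexical lex? v × colour v ∉ allReserved (Ps M)
    clean? : Decidable₁ Clean
    clean? v = lexical? v ×-dec ¬? (_ ∈? _)
    foreign-label : ∀ {v u w} → Clean v → Clean u → Foreign f colour v u → Clean w → f v u ≢ colour w
    foreign-label {v} {u} (lv , cv∉) (lu , cu∉) fo (_ , cw∉) e =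
      maximal v u (lv , lu , fo , cv∉ , cu∉ , subst (_∉ allReserved (Ps M)) (sym e) cw∉)
    clean-classes : ∀ γ → # (λ w → clean? w ×-dec (colour w F.≟ γ)) ≤ 5 * s
    clean-classes γ = ≤-trans (#-mono (λ w ((l , _) , e) → l , e) (λ w → clean? w ×-dec (colour w F.≟ γ))
      (λ w → lexical? w ×-dec (colour w F.≟ γ))) (small-classes γ)
    open Levels {s = s} {t = t} 1≤s 1≤t f-sym _⟶?_ total outdegree lex? lex-colour β<N clean? proj₁ clean-classes foreign-label
      using (many-clean)
    removed? : ∀ v → Dec (IsLexical lex? v × colour v ∈ allReserved (Ps M))
    removed? v = lexical? v ×-dec (_ ∈? _)
    lexical≤ : # lexical? ≤ # clean? + 45 * (s * t)
    lexical≤ = begin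
      # lexical? ≤⟨ #-⊎ cases lexical? clean? removed? ⟩
      # clean? + # removed?
        ≤⟨ +-monoʳ-≤ (# clean?) (#-colours lexical? colour (small-classes) (allReserved (Ps M))) ⟩
      # clean? + 5 * s * length (allReserved (Ps M)) ≡⟨ cong (λ z → # clean? + 5 * s * z) (|reserved| M) ⟩
      # clean? + 5 * s * (3 * m) ≤⟨ +-monoʳ-≤ (# clean?) (*-monoʳ-≤ (5 * s) (*-monoʳ-≤ 3 m≤3t)) ⟩
      # clean? + 5 * s * (3 * (3 * t)) ≡⟨ cong (# clean? +_) (arith s t) ⟩
      # clean? + 45 * (s * t) ∎
      where
      arith : ∀ s t → 5 * s * (3 * (3 * t)) ≡ 45 * (s * t)
      arith = solve-∀
      cases : ∀ v → IsLexical lex? v → Clean v ⊎ (IsLexical lex? v × colour v ∈ allReserved (Ps M))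
      cases v l = split (_ ∈? _)
        where
        split : Dec (colour v ∈ allReserved (Ps M)) →
                Clean v ⊎ (IsLexical lex? v × colour v ∈ allReserved (Ps M))
        split (yes h) = inj₂ (l , h)
        split (no ¬h) = inj₁ (l , ¬h)
    many : 2400 * (s * t) ≤ # clean?
    -- The 1780 is 4 · 45 + 1600, from the removed vertices and from `many-lexical`; 9600 + 1780 + 2
    -- + 618 = 12000.
    many = *-cancelˡ-≤ 4 (+-cancelʳ-≤ (1780 * (s * t) + 2) _ _ (begin
      4 * (2400 * (s * t)) + (1780 * (s * t) + 2)
        ≤⟨ +-monoʳ-≤ (4 * (2400 * (s * t))) (+-monoʳ-≤ (1780 * (s * t)) (*-monoʳ-≤ 2 1≤st)) ⟩
      4 * (2400 * (s * t)) + (1780 * (s * t) + 2 * (s * t)) ≤⟨ m≤m+n _ (618 * (s * t)) ⟩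
      4 * (2400 * (s * t)) + (1780 * (s * t) + 2 * (s * t)) + 618 * (s * t) ≡⟨ arith₁ (s * t) ⟩
      12000 * (s * t) ≤⟨ N-large ⟩
      N ≤⟨ many-lexical ⟩
      4 * # lexical? + (1600 * (s * t) + 2) ≤⟨ +-monoˡ-≤ _ (*-monoʳ-≤ 4 lexical≤) ⟩
      4 * (# clean? + 45 * (s * t)) + (1600 * (s * t) + 2) ≡⟨ arith₂ (# clean?) (s * t) ⟩
      4 * # clean? + (1780 * (s * t) + 2) ∎))
      where
      arith₁ : ∀ x → 4 * (2400 * x) + (1780 * x + 2 * x) + 618 * x ≡ 12000 * x
      arith₁ = solve-∀
      arith₂ : ∀ c x → 4 * (c + 45 * x) + (1600 * x + 2) ≡ 4 * c + (1780 * x + 2)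
      arith₂ = solve-∀

  rainbowPath : RainbowPath f t
  rainbowPath = [ full , stuck ]′ (harvest (3 * t))

-- From oriented colourings to the Ramsey bound.

module Main {N B s t : ℕ} (1≤s : 1 ≤ s) (1≤t : 1 ≤ t) (N-large : 12000 * (s * t) ≤ N)
  {f : Fin N → Fin N → Fin B} (f-sym : ∀ u v → f u v ≡ f v u)
  {_⟶_ : Fin N → Fin N → Set} (_⟶?_ : Decidable _⟶_)
  (total : ∀ {u v} → u ≢ v → u ⟶ v ⊎ v ⟶ u)
  (outdegree : ∀ v γ → # (λ w → (v ⟶? w) ×-dec (f v w F.≟ γ)) ≤ s)
  where

  open Lexical {t = t} 1≤s f-sym _⟶?_ total outdegree using (Entangled?; core⇒rainbow; colour; lex?; lexical?; many-lexical; small-classes)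

  1≤N : 1 ≤ N
  1≤N = ≤-trans (*-mono-≤ (s≤s {0} {11999} z≤n) (*-mono-≤ 1≤s 1≤t)) N-large

  β<N : 75 * (30 * t) < N
  β<N = <-≤-trans (begin-strict
    75 * (30 * t) ≡⟨ arith t ⟩
    2250 * t <⟨ *-monoˡ-< t ⦃ >-nonZero 1≤t ⦄ (m<m+n 2250 {9750} (s≤s z≤n)) ⟩
    12000 * t ≤⟨ *-monoʳ-≤ 12000 (m≤n*m t s ⦃ >-nonZero 1≤s ⦄) ⟩
    12000 * (s * t) ∎) N-large
    where
    open ≤-Reasoning
    arith : ∀ t → 75 * (30 * t) ≡ 2250 * t
    arith = solve-∀

  rainbowPath : RainbowPath f t
  rainbowPath = [ core⇒rainbow , (λ ranking →
    Harvest.rainbowPath 1≤s 1≤t N-large f-sym _⟶?_ total outdegree (lex? ranking) proj₂ β<N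
      (lexical? ranking) (small-classes ranking 1≤N) (many-lexical ranking 1≤N)) ]′ (peel Entangled? t)

finite-⊎ : ∀ n {A : Set} {P : Fin n → Set} → (∀ i → A ⊎ P i) → A ⊎ (∀ i → P i)
finite-⊎ zero    h = inj₂ λ ()
finite-⊎ (suc n) h with h zero | finite-⊎ n (h ∘ suc)
... | inj₁ a | _ = inj₁ a
... | inj₂ _ | inj₁ a = inj₁ a
... | inj₂ p | inj₂ ps = inj₂ λ { zero → p ; (suc i) → ps i }

term≤sum : ∀ {n} (g : Fin n → ℕ) i → g i ≤ sum g
term≤sum g zero    = m≤m+n _ _
term≤sum g (suc i) = ≤-trans (term≤sum (g ∘ suc) i) (m≤n+m _ (g zero))

module _ {s t N : ℕ} {S : Graph s} (tree : IsTree S) (1≤s : 1 ≤ s) (1≤t : 1 ≤ t) (N-large : 12000 * (s * t) ≤ N)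
         (c : Colouring N) (c-sym : IsEdgeColouring c) where

  private
    simple = proj₁ tree

    -- The sum of all colours bounds each of them, so the colouring can be read as one with the
    -- finite palette `Fin B`.
    B : ℕ
    B = suc (sum λ u → sum λ v → c u v)

    f : Fin N → Fin N → Fin B
    f u v = fromℕ< (s≤s (≤-trans (term≤sum (c u) v) (term≤sum (λ u → sum (c u)) u)))

    f≡c : ∀ u v → toℕ (f u v) ≡ c u v
    f≡c u v = F.toℕ-fromℕ< _

    c⇒f : ∀ u v u′ v′ → c u v ≡ c u′ v′ → f u v ≡ f u′ v′
    c⇒f u v u′ v′ e = F.toℕ-injective (trans (f≡c u v) (trans e (sym (f≡c u′ v′))))

    f-sym : ∀ u v → f u v ≡ f v u
    f-sym u v = c⇒f u v v u (c-sym u v)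

    -- Loops are excluded because a colouring also has values on the diagonal.
    Class : Fin B → Fin N → Fin N → Set
    Class γ u v = u ≢ v × f u v ≡ γ

    class? : ∀ γ → Decidable (Class γ)
    class? γ u v = ¬? (u F.≟ v) ×-dec (f u v F.≟ γ)

    mono : ∀ γ → Core (class? γ) s → MonoCopy S c
    mono γ core =
      let _ , grown , all = Tree.tree-order S simple (proj₁ (proj₂ tree)) (proj₂ (proj₂ tree)) (fromℕ< 1≤s)
          φ , φ-inj , edge = embedTree (class? γ) s (λ { {u} {v} (u≢v , e) → u≢v ∘ sym , trans (f-sym v u) e }) core simple grown all
      in φ , φ-inj , toℕ γ , λ u v h → trans (sym (f≡c (φ u) (φ v))) (cong toℕ (proj₂ (edge u v (Equivalence.to T-≡ h))))

    module Oriented (rankings : ∀ γ → Ranking (class? γ) s) where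

      level : Fin B → Fin N → ℕ
      level γ = Ranking.rank (rankings γ)

      -- Every edge points upwards in the ranking of its own colour class, so `few-above` becomes
      -- the outdegree bound.
      _⟶_ : Fin N → Fin N → Set
      u ⟶ v = u ≢ v × level (f u v) u < level (f u v) v

      _⟶?_ : Decidable _⟶_
      u ⟶? v = ¬? (u F.≟ v) ×-dec (_ <? _)

      total : ∀ {u v} → u ≢ v → u ⟶ v ⊎ v ⟶ u
      total {u} {v} u≢v = cases (<-cmp (level (f u v) u) (level (f u v) v))
        where
        cases : Tri _ _ _ → u ⟶ v ⊎ v ⟶ u
        cases (tri< lt _ _) = inj₁ (u≢v , lt)
        cases (tri≈ _ eq _) = contradiction (Ranking.rank-injective (rankings (f u v)) eq) u≢v
        cases (tri> _ _ gt) = inj₂ (u≢v ∘ sym , subst (λ γ → level γ v < level γ u) (f-sym u v) gt)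

      outdegree : ∀ v γ → # (λ w → (v ⟶? w) ×-dec (f v w F.≟ γ)) ≤ s
      outdegree v γ = ≤-trans (#-mono (λ { w ((v≢w , lt) , refl) → (v≢w , refl) , lt })
        (λ w → (v ⟶? w) ×-dec (f v w F.≟ γ)) (λ w → class? γ v w ×-dec (level γ v <? level γ w)))
        (<⇒≤ (Ranking.few-above (rankings γ) v))

  -- A core in one colour class contains the tree; if no class has one, the rankings of all classes
  -- orient the complete graph.
  mono-or-rainbow : MonoCopy S c ⊎ RainbowCopy (PathGraph t) c
  mono-or-rainbow = map₂
    (λ rankings → let open Oriented rankings in
      rainbowCopy f-sym c⇒f (Main.rainbowPath 1≤s 1≤t N-large f-sym _⟶?_ total outdegree))
    (finite-⊎ B λ γ → map₁ (mono γ) (peel (class? γ) s))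

α≥1 : ∀ k → 1 ≤ k → ∀ t → 2 ≤ t → 1 ≤ α k t
α≥1 (suc zero)    _ (suc (suc t)) _ = s≤s z≤n
α≥1 (suc (suc k)) _ (suc (suc t)) _ = s≤s z≤n
α≥1 _ _ (suc zero) (s≤s ())

theorem1p4 : ∀ (k : ℕ) → 1 ≤ k → ∃ λ (A : ℕ) →
    ∀ (s : ℕ) (S : Graph s) → IsTree S → ∀ (t : ℕ) → 2 ≤ t →
    f≤ S (PathGraph t) (A * s * t * α k t)
theorem1p4 k 1≤k = 12000 , bound
  where
  bound : ∀ s (S : Graph s) → IsTree S → ∀ t → 2 ≤ t → f≤ S (PathGraph t) (12000 * s * t * α k t)
  -- The graph without vertices embeds in the empty complete graph; the colour 0 is a default.
  bound zero S tree t 2≤t = 0 , z≤n , λ c _ → inj₁ ((λ ()) , (λ { {()} }) , 0 , λ ())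
  bound (suc s) S tree t 2≤t = 12000 * suc s * t
    -- The bound without the Ackermann factor is enough, since `α k t` is positive.
    , m≤m*n (12000 * suc s * t) (α k t) ⦃ >-nonZero (α≥1 k 1≤k t 2≤t) ⦄
    , mono-or-rainbow tree (s≤s z≤n) (≤-trans (s≤s z≤n) 2≤t) (≤-reflexive (sym (*-assoc 12000 (suc s) t)))
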